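{- Let $\mathcal{U}$ be a strategic $(p^+)$-filter on $E$. Then every Borel set $\mathbb{A}\subseteq 2^\omega\times E^{[\infty]}$ is perfectly $\mathcal{U}$-strategically Ramsey.
   Context: $F$ is a countable field and $E$ a countably infinite-dimensional $F$-vector space with fixed basis $(e_n)$; $\mathrm{supp}(v)$ is the set of indices of nonzero coefficients of $v\ne0$. Block sequences: sequences of nonzero vectors with $\max\mathrm{supp}(x_n)<\min\mathrm{supp}(x_{n+1})$; $E^{[\infty]}$ (Polish, subspace of $E^\omega$) and $E^{[<\infty]}$ are the infinite and finite ones. $Y\preceq X$ iff $\langle Y\rangle\subseteq\langle X\rangle$; $Y\preceq^*X$ iff some tail of $Y$ is $\preceq X$. Family: nonempty subset of $E^{[\infty]}$ upward closed under $\preceq^*$; filter: family whose any two members have a common $\preceq$-lower bound in it; $\mathcal{H}\restriction X=\{Y\in\mathcal{H}:Y\preceq X\}$. Full: whenever $D\subseteq E$ and $X\in\mathcal{H}$ are such that every $Y\in\mathcal{H}\restriction X$ has some $Z\preceq Y$ with $\langle Z\rangle\subseteq D$, there is $Z\in\mathcal{H}\restriction X$ with $\langle Z\rangle\subseteq D$. $(p)$: every $\preceq$-decreasing sequence in $\mathcal{H}$ has a member of $\mathcal{H}$ that is $\preceq^*$ each term; $(p^+)$-filter: full filter with $(p)$. Strategic: whenever $X\in\mathcal{H}$ and $\alpha$ is a strategy for II in $G[X]$, some outcome of $\alpha$ lies in $\mathcal{H}$. Games for $\vec x\in E^{[<\infty]}$, $X\in E^{[\infty]}$: in $F[\vec x,X]$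 I plays $n_k\in\omega$, II plays nonzero $y_k\in\langle X\rangle$ with $n_k<\min\mathrm{supp}(y_k)$; in $G[\vec x,X]$ I plays $Y_k\in E^{[\infty]}$, $Y_k\preceq X$, II plays nonzero $y_k\in\langle Y_k\rangle$; II's moves are supported above $\vec x$ and form a block sequence; outcome $\vec x^\frown(y_k)$; $G[X]=G[\emptyset,X]$. $[\sigma]$ is the set of outcomes of plays where I follows $\sigma$. $\mathbb{S}$: nonempty perfect subtrees of $2^{<\omega}$ ordered by inclusion; $[p]$ the branches of $p$. $\mathbb{A}$ is perfectly $\mathcal{U}$-strategically Ramsey if for every $\vec x\in E^{[<\infty]}$, $X\in\mathcal{U}$ and $p\in\mathbb{S}$ there are $Y\in\mathcal{U}\restriction X$ and $q\le p$ such that either (i) I has a strategy $\sigma$ in $F[\vec x,Y]$ with $([q]\times[\sigma])\cap\mathbb{A}=\emptyset$, or (ii) for every $f\in[q]$, II has a strategy in $G[\vec x,Y]$ all of whose outcomes lie in $\mathbb{A}_f=\{Z:(f,Z)\in\mathbb{A}\}$. -}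

module Defs where

open import Level using (Level; _⊔_; 0ℓ) renaming (suc to lsuc)
open import Algebra.Bundles using (CommutativeRing)
open import Algebra.Module.Bundles using (LeftModule)
import Algebra.Definitions.RawMonoid as RawMonoidDefs
open import Data.Bool.Base using (Bool; true; false)
open import Data.Fin.Base using (toℕ; fromℕ<)
open import Data.List.Base using (List; []; _∷_; _++_; _∷ʳ_; applyUpTo)
open import Data.List.Relation.Binary.Pointwise.Base using (Pointwise)
open import Data.List.Relation.Unary.All using (All)
open import Data.List.Relation.Unary.Linked using (Linked)
open import Data.Nat.Base using (ℕ; zero; suc; _+_; _<_)
open import Data.Nat.Properties using (_<?_)
open import Data.Product.Base using (∃-syntax; Σ-syntax; _×_; _,_; proj₁; proj₂)
open import Data.Sum.Base using (_⊎_)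
open import Data.Vec.Functional using (Vector)
open import Function.Bundles using (Surjection)
open import Relation.Binary.Definitions using (_Respects_)
open import Relation.Binary.PropositionalEquality using (_≡_) renaming (setoid to ≡-setoid)
open import Relation.Nullary using (¬_; yes; no)
open import Relation.Unary using (Pred; _∈_; _⊆_; _≐_; ∁; ⋃)

record Field (c ℓ : Level) : Set (lsuc (c ⊔ ℓ)) where
  field
    commutativeRing : CommutativeRing c ℓ
  open CommutativeRing commutativeRing public
  field
    1≉0     : ¬ (1# ≈ 0#)
    inverse : ∀ x → ¬ (x ≈ 0#) → ∃[ y ] (x * y ≈ 1#)

-- A field is nonempty, so this covers exactly the finite and the countably
-- infinite fields.
Countable : ∀ {c ℓ} → Field c ℓ → Set (c ⊔ ℓ)
Countable F = Surjection (≡-setoid ℕ) (Field.setoid F)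

record SpaceWithBasis {c ℓ : Level} (F : Field c ℓ) (m ℓm : Level)
    : Set (c ⊔ ℓ ⊔ lsuc (m ⊔ ℓm)) where
  module F = Field F
  field
    leftModule : LeftModule F.ring m ℓm
  open LeftModule leftModule public
  open RawMonoidDefs +ᴹ-rawMonoid using (sum)

  combination : (ℕ → Carrierᴹ) → ∀ {n} → Vector F.Carrier n → Carrierᴹ
  combination x a = sum (λ i → a i *ₗ x (toℕ i))

  field
    e           : ℕ → Carrierᴹ
    spanning    : ∀ v → Σ[ n ∈ ℕ ] Σ[ a ∈ Vector F.Carrier n ] (v ≈ᴹ combination e a)
    independent : ∀ {n} (a : Vector F.Carrier n) →
                  combination e a ≈ᴹ 0ᴹ → ∀ i → a i F.≈ F.0#

  -- Independent, up to ≈, of the expansion that spanning provides.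
  coeff : Carrierᴹ → ℕ → F.Carrier
  coeff v i with i <? proj₁ (spanning v)
  ... | yes i<n = proj₁ (proj₂ (spanning v)) (fromℕ< i<n)
  ... | no  _   = F.0#

Cantor : Set
Cantor = ℕ → Bool

-- The conditions of Sacks forcing; nodes are listed from the root.
record PerfectTree : Set₁ where
  field
    node      : Pred (List Bool) 0ℓ
    nonempty  : ∃[ s ] node s
    initial   : ∀ s t → node (s ++ t) → node s
    splitting : ∀ s → node s →
                ∃[ t ] (node ((s ++ t) ∷ʳ false) × node ((s ++ t) ∷ʳ true))

open PerfectTree using (node)

_≤𝕊_ : PerfectTree → PerfectTree → Set
q ≤𝕊 p = node q ⊆ node p

Branches : PerfectTree → Pred Cantor 0ℓ
Branches p f = ∀ n → applyUpTo f n ∈ node p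

module BlockSequences {c ℓ m ℓm : Level} {F : Field c ℓ} (E : SpaceWithBasis F m ℓm) where

  open SpaceWithBasis E

  V : Set m
  V = Carrierᴹ

  supp : V → Pred ℕ ℓ
  supp v i = ¬ (coeff v i F.≈ F.0#)

  NonzeroV : V → Set ℓm
  NonzeroV v = ¬ (v ≈ᴹ 0ᴹ)

  -- n < min supp v, for nonzero v.
  _<supp_ : ℕ → V → Set ℓ
  n <supp v = ∀ {j} → j ∈ supp v → n < j

  -- max supp v < min supp w, for nonzero v and w.
  _≺_ : V → V → Set ℓ
  v ≺ w = ∀ {i} → i ∈ supp v → i <supp w

  IsBlock : (ℕ → V) → Set (ℓ ⊔ ℓm)
  IsBlock x = (∀ n → NonzeroV (x n)) × (∀ n → x n ≺ x (suc n))

  record BlockSeq : Set (m ⊔ ℓm ⊔ ℓ) where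
    field
      seq     : ℕ → V
      isBlock : IsBlock seq

  open BlockSeq public

  record FinBlockSeq : Set (m ⊔ ℓm ⊔ ℓ) where
    field
      entries : List V
      nonzero : All NonzeroV entries
      block   : Linked _≺_ entries

  open FinBlockSeq public using (entries)

  ∅ : FinBlockSeq
  ∅ = record { entries = [] ; nonzero = All.[] ; block = Linked.[] }

  -- Equality of infinite sequences of vectors.
  _≋_ : (ℕ → V) → (ℕ → V) → Set ℓm
  x ≋ y = ∀ n → x n ≈ᴹ y n

  ⟨_⟩ : (ℕ → V) → Pred V (c ⊔ ℓm)
  ⟨ x ⟩ v = Σ[ n ∈ ℕ ] Σ[ a ∈ Vector F.Carrier n ] (v ≈ᴹ combination x a)

  _≼_ : BlockSeq → BlockSeq → Set (c ⊔ m ⊔ ℓm)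
  Y ≼ X = ⟨ seq Y ⟩ ⊆ ⟨ seq X ⟩

  _≼*_ : BlockSeq → BlockSeq → Set (c ⊔ m ⊔ ℓm)
  Y ≼* X = ∃[ n ] (⟨ (λ k → seq Y (n + k)) ⟩ ⊆ ⟨ seq X ⟩)

  -- Finite sequence followed by an infinite one.
  _⌢_ : List V → (ℕ → V) → (ℕ → V)
  ([]       ⌢ y) n       = y n
  ((v ∷ vs) ⌢ y) zero    = v
  ((v ∷ vs) ⌢ y) (suc n) = (vs ⌢ y) n

  Above : FinBlockSeq → (ℕ → V) → Set (m ⊔ ℓ)
  Above x y = ∀ k → All (λ v → v ≺ y k) (entries x)

  -- A strategy for I in F[x,X] answers II's moves y₀,…,yₖ₋₁ by nₖ.  Every
  -- natural number is a legal move for I, so x and X only matter for the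
  -- outcomes.  Vectors form a setoid, hence the congruence condition, as for
  -- StrategyII below.
  record StrategyI : Set (m ⊔ ℓm) where
    field
      move : List V → ℕ
      cong : ∀ {vs ws} → Pointwise _≈ᴹ_ vs ws → move vs ≡ move ws

  OutcomesI : FinBlockSeq → BlockSeq → StrategyI → Pred BlockSeq (c ⊔ m ⊔ ℓm ⊔ ℓ)
  OutcomesI x X σ Z =
    Σ[ y ∈ (ℕ → V) ]
      ( IsBlock y
      × Above x y
      × (∀ k → y k ∈ ⟨ seq X ⟩)
      × (∀ k → StrategyI.move σ (applyUpTo y k) <supp y k)
      × seq Z ≋ (entries x ⌢ y))

  -- A strategy for II in G[x,X] answers I's moves Y₀,…,Yₖ by yₖ.  The value of
  -- move at [], and at lists containing some Y that is not ≼ X, plays no role.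
  -- Every finite run of legal moves of I extends to an infinite one, so legality
  -- of II's answers need only be required along infinite runs.
  record StrategyII (x : FinBlockSeq) (X : BlockSeq) : Set (c ⊔ m ⊔ ℓm ⊔ ℓ) where
    field
      move : List BlockSeq → V
      cong : ∀ {Ys Zs} → Pointwise (λ Y Z → seq Y ≋ seq Z) Ys Zs → move Ys ≈ᴹ move Zs

    response : (ℕ → BlockSeq) → (ℕ → V)
    response Y k = move (applyUpTo Y (suc k))

    field
      legal : ∀ (Y : ℕ → BlockSeq) → (∀ k → Y k ≼ X) →
                IsBlock (response Y)
              × Above x (response Y)
              × (∀ k → response Y k ∈ ⟨ seq (Y k) ⟩)

  OutcomesII : ∀ {x X} → StrategyII x X → Pred BlockSeq (c ⊔ m ⊔ ℓm ⊔ ℓ)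
  OutcomesII {x} {X} α Z =
    Σ[ Y ∈ (ℕ → BlockSeq) ]
      ( (∀ k → Y k ≼ X)
      × seq Z ≋ (entries x ⌢ StrategyII.response α Y))

  _↾_ : ∀ {u} → Pred BlockSeq u → BlockSeq → Pred BlockSeq (u ⊔ c ⊔ m ⊔ ℓm)
  (H ↾ X) Y = Y ∈ H × Y ≼ X

  record IsFamily {u : Level} (H : Pred BlockSeq u) : Set (u ⊔ c ⊔ m ⊔ ℓm ⊔ ℓ) where
    field
      nonempty     : ∃[ X ] X ∈ H
      upwardClosed : ∀ {X Y} → X ∈ H → X ≼* Y → Y ∈ H

  record IsFilter {u : Level} (H : Pred BlockSeq u) : Set (u ⊔ c ⊔ m ⊔ ℓm ⊔ ℓ) where
    field
      isFamily   : IsFamily H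
      lowerBound : ∀ {X Y} → X ∈ H → Y ∈ H → ∃[ Z ] (Z ∈ H × Z ≼ X × Z ≼ Y)

  -- Under excluded middle a predicate at any level is equivalent to one at level
  -- zero, so D ranges over all subsets of E; similarly for the nodes of trees.
  Full : ∀ {u} → Pred BlockSeq u → Set (u ⊔ c ⊔ m ⊔ ℓm ⊔ ℓ ⊔ lsuc 0ℓ)
  Full H = ∀ (D : Pred V 0ℓ) → D Respects _≈ᴹ_ → ∀ X → X ∈ H →
    (∀ Y → Y ∈ (H ↾ X) → ∃[ Z ] (Z ≼ Y × ⟨ seq Z ⟩ ⊆ D)) →
    ∃[ Z ] (Z ∈ (H ↾ X) × ⟨ seq Z ⟩ ⊆ D)

  PropertyP : ∀ {u} → Pred BlockSeq u → Set (u ⊔ c ⊔ m ⊔ ℓm ⊔ ℓ)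
  PropertyP H = ∀ (X : ℕ → BlockSeq) → (∀ n → X n ∈ H) → (∀ n → X (suc n) ≼ X n) →
    ∃[ Y ] (Y ∈ H × (∀ n → Y ≼* X n))

  record IsP⁺Filter {u : Level} (H : Pred BlockSeq u)
      : Set (u ⊔ c ⊔ m ⊔ ℓm ⊔ ℓ ⊔ lsuc 0ℓ) where
    field
      isFilter  : IsFilter H
      full      : Full H
      propertyP : PropertyP H

  Strategic : ∀ {u} → Pred BlockSeq u → Set (u ⊔ c ⊔ m ⊔ ℓm ⊔ ℓ)
  Strategic H = ∀ X → X ∈ H → (α : StrategyII ∅ X) → ∃[ Z ] (Z ∈ OutcomesII α × Z ∈ H)

  Point : Set (m ⊔ ℓm ⊔ ℓ)
  Point = Cantor × BlockSeq

  AgreeBelow : ℕ → Point → Point → Set ℓm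
  AgreeBelow n (f , X) (g , Y) = ∀ i → i < n → f i ≡ g i × seq X i ≈ᴹ seq Y i

  -- The product topology, with 2 and E discrete.
  Open : ∀ {a} → Pred Point a → Set (a ⊔ m ⊔ ℓm ⊔ ℓ)
  Open A = ∀ P → P ∈ A → ∃[ n ] (∀ Q → AgreeBelow n P Q → Q ∈ A)

  -- The σ-algebra generated by the open sets; ext closes it under extensional
  -- equality of predicates.
  data Borel {a : Level} : Pred Point a → Set (lsuc a ⊔ m ⊔ ℓm ⊔ ℓ) where
    open-set   : ∀ {A : Pred Point a} → Open A → Borel A
    complement : ∀ {A : Pred Point a} → Borel A → Borel (∁ A)
    union      : ∀ {A : ℕ → Pred Point a} → (∀ n → Borel (A n)) → Borel (⋃ ℕ A)
    ext        : ∀ {A B : Pred Point a} → A ≐ B → Borel A → Borel B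

  PerfectlyStrategicallyRamsey : ∀ {u a} → Pred BlockSeq u → Pred Point a →
                                 Set (u ⊔ a ⊔ c ⊔ m ⊔ ℓm ⊔ ℓ ⊔ lsuc 0ℓ)
  PerfectlyStrategicallyRamsey U A =
    ∀ (x : FinBlockSeq) (X : BlockSeq) → X ∈ U → (p : PerfectTree) →
    Σ[ Y ∈ BlockSeq ] Σ[ q ∈ PerfectTree ]
      ( Y ∈ (U ↾ X)
      × q ≤𝕊 p
      × ( (Σ[ σ ∈ StrategyI ]
             (∀ f Z → f ∈ Branches q → Z ∈ OutcomesI x Y σ → ¬ ((f , Z) ∈ A)))
        ⊎ (∀ f → f ∈ Branches q →
             Σ[ α ∈ StrategyII x Y ] (∀ Z → Z ∈ OutcomesII α → (f , Z) ∈ A))))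

{-# OPTIONS --safe #-}

-- Write A as the projection of a closed set C of triples (f , Z , w), w a sequence of natural
-- numbers.  A position x with a finite part s of the witness w is open for II below a condition
-- (a perfect tree) if no stronger condition q admits a strategy for I in some F[x,Y], Y ∈ U, that
-- keeps (f , Z) out of the projection of C restricted to w extending s, for all branches f of q.
--
-- If (x , s) is open for II, then densely below it II can force the game to some position y, with
-- some d ≤ |y|, such that (y , s⌢d) is open for II.  Otherwise I can avoid all these positions,
-- and so wins at each y against the finitely many s⌢d with d ≤ |y|; playing all these
-- strategies together, I wins at (x , s).  Starting from (x , ∅), II can thus extend the witness
-- again and again, and since C is closed the outcome lies in the section of A.
--
-- All this takes place simultaneously for the branches f of a condition.  There are countably
-- many positions, so fusion decides which of them are open, and (p) yields a single Y.  The one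
-- step that is not a fusion is fullness of U for subsets of E that depend on f.

module Submission where

open import Defs
open import Level using (Level; _⊔_; 0ℓ; Lift; lift; lower)
open import Axiom.ExcludedMiddle using (ExcludedMiddle)
open import Data.Bool.Base using (Bool; true; false; T)
import Data.Bool.Properties as Bool
open import Data.Empty using (⊥; ⊥-elim)
open import Data.Fin.Base using (fromℕ<) renaming (zero to fzero; suc to fsuc)
open import Data.List.Base using (List; []; _∷_; _++_; _∷ʳ_; [_]; applyUpTo; drop; length; map; take)
import Data.List.Properties as List
open import Data.List.Relation.Binary.Pointwise.Base using (Pointwise; []; _∷_)
open import Data.List.Relation.Unary.All as All using (All; []; _∷_)
import Data.List.Relation.Unary.All.Properties as All
open import Data.Nat.Base renaming (_⊔_ to _⊔ⁿ_)
open import Data.Nat.Properties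
open import Data.Product.Base using (∃-syntax; Σ; Σ-syntax; _×_; _,_; proj₁; proj₂)
open import Data.Sum.Base using (_⊎_; inj₁; inj₂)
open import Data.Unit.Base using (⊤; tt)
open import Data.Vec.Functional using (Vector)
open import Function.Base using (_∘_; id; case_of_)
open import Function.Bundles using (Surjection)
import Relation.Binary.Reasoning.Setoid as SetoidReasoning
open import Relation.Binary.PropositionalEquality using (_≡_; refl; sym; trans; cong; cong₂; subst; subst₂)
open import Relation.Nullary using (¬_; Dec; yes; no; does; recompute)
open import Relation.Unary using (Pred; _∈_; _⊆_; ∁; ⋃)

-- The vectors that bring II forward form a set depending on the branch f, so `Full` does not apply
-- to it: there are uncountably many such sets, and one member of `U` must serve all f at once.
-- `Fullness` therefore asks only whether a finite run of moves extends below some stronger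
-- condition. The vectors that do this form a single subset of E, to which `Full` applies. The
-- stronger condition varies with the vector; along one play these conditions form a fusion, and
-- `Strategic` puts the outcome of such a play into `U`.
--
-- Fusion settles a question only at the nodes of some later level. For player I the answers at
-- these nodes are merged, because finitely many members of `U` have a common lower bound. For
-- player II it is enough to follow a single branch until the question is settled, since the
-- strategy may depend on f.
--
-- Conditions are embeddings of the binary tree. A branch is then given by an address `g`, and every
-- `e ↾ applyUpTo g n` is again a condition, so that facts about a branch become facts about
-- conditions along `g`.

private
  variable
    𝓁 : Level
    A : Set 𝓁

-- Enumerations

-- One step of Cantor's walk along the antidiagonals.
nextPair : ℕ × ℕ → ℕ × ℕ
nextPair (zero  , b) = suc b , zero
nextPair (suc a , b) = a , suc b

unpair : ℕ → ℕ × ℕ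
unpair zero    = 0 , 0
unpair (suc n) = nextPair (unpair n)

unpair-surjective : ∀ a b → ∃[ n ] unpair n ≡ (a , b)
unpair-surjective a b = go (a + b) a b refl
  where
  go : ∀ s a b → a + b ≡ s → ∃[ n ] unpair n ≡ (a , b)
  go zero    zero zero    _ = 0 , refl
  go (suc s) (suc a) zero p with go s zero a (trans (sym (+-identityʳ a)) (suc-injective p))
  ... | n , q = suc n , cong nextPair q
  go s a (suc b) p with go s (suc a) b (trans (sym (+-suc a b)) p)
  ... | n , q = suc n , cong nextPair q

pair : ℕ → ℕ → ℕ
pair a b = proj₁ (unpair-surjective a b)

unpair-pair : ∀ a b → unpair (pair a b) ≡ (a , b)
unpair-pair a b = proj₂ (unpair-surjective a b)

record Enumerable (A : Set 𝓁) : Set 𝓁 where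
  field
    enum       : ℕ → A
    surjective : ∀ x → ∃[ n ] enum n ≡ x

open Enumerable {{...}} public

instance
  ℕ-enumerable : Enumerable ℕ
  ℕ-enumerable = record { enum = id ; surjective = λ n → n , refl }

  Bool-enumerable : Enumerable Bool
  Bool-enumerable = record
    { enum = λ { zero → false ; (suc _) → true }
    ; surjective = λ { false → 0 , refl ; true → 1 , refl } }

  ×-enumerable : ∀ {b} {B : Set b} {{_ : Enumerable A}} {{_ : Enumerable B}} → Enumerable (A × B)
  ×-enumerable = record
    { enum = λ n → enum (proj₁ (unpair n)) , enum (proj₂ (unpair n))
    ; surjective = λ { (x , y) → pair (proj₁ (surjective x)) (proj₁ (surjective y)) ,
        trans (cong (λ p → enum (proj₁ p) , enum (proj₂ p)) (unpair-pair _ _))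
              (cong₂ _,_ (proj₂ (surjective x)) (proj₂ (surjective y))) } }

  List-enumerable : {{_ : Enumerable A}} → Enumerable (List A)
  List-enumerable {A = A} = record
    { enum = λ n → decode (proj₁ (unpair n)) (proj₂ (unpair n))
    ; surjective = λ xs → pair (length xs) (encode xs) ,
        trans (cong (λ p → decode (proj₁ p) (proj₂ p)) (unpair-pair _ _)) (decode-encode xs) }
    where
    decode : ℕ → ℕ → List A
    decode zero    m = []
    decode (suc k) m = enum (proj₁ (unpair m)) ∷ decode k (proj₂ (unpair m))
    encode : List A → ℕ
    encode []       = 0
    encode (x ∷ xs) = pair (proj₁ (surjective x)) (encode xs)
    decode-encode : ∀ xs → decode (length xs) (encode xs) ≡ xs
    decode-encode []       = refl
    decode-encode (x ∷ xs) rewrite unpair-pair (proj₁ (surjective x)) (encode xs) =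
      cong₂ _∷_ (proj₂ (surjective x)) (decode-encode xs)

-- Initial segments of sequences

nth : A → List A → ℕ → A
nth d []       n       = d
nth d (x ∷ xs) zero    = x
nth d (x ∷ xs) (suc n) = nth d xs n

nth-++ : ∀ (d : A) xs ys i → i < length xs → nth d (xs ++ ys) i ≡ nth d xs i
nth-++ d (x ∷ xs) ys zero    p       = refl
nth-++ d (x ∷ xs) ys (suc i) (s≤s p) = nth-++ d xs ys i p

infix 4 _◂_

_◂_ : List A → (ℕ → A) → Set _
t ◂ f = applyUpTo f (length t) ≡ t

◂-∷ : ∀ {x : A} {t f} → f 0 ≡ x → t ◂ f ∘ suc → x ∷ t ◂ f
◂-∷ = cong₂ _∷_

◂-nth : ∀ (d : A) {t f} → t ◂ f → ∀ i → i < length t → f i ≡ nth d t i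
◂-nth d {x ∷ t} p zero    _       = List.∷-injectiveˡ p
◂-nth d {x ∷ t} {f} p (suc i) (s≤s q) = ◂-nth d {t} {f ∘ suc} (List.∷-injectiveʳ p) i q

nth-◂ : ∀ (d : A) t {f} → (∀ i → i < length t → f i ≡ nth d t i) → t ◂ f
nth-◂ d []      p = refl
nth-◂ d (x ∷ t) {f} p = ◂-∷ {t = t} {f} (p 0 z<s) (nth-◂ d t {f ∘ suc} (λ i q → p (suc i) (s≤s q)))

◂-++ˡ : ∀ (t r : List A) {f} → t ++ r ◂ f → t ◂ f
◂-++ˡ []      r p = refl
◂-++ˡ (x ∷ t) r {f} p = ◂-∷ {t = t} {f} (List.∷-injectiveˡ p) (◂-++ˡ t r {f ∘ suc} (List.∷-injectiveʳ p))

◂-agree : ∀ (t : List A) {f g} → t ◂ f → t ◂ g → ∀ i → i < length t → f i ≡ g i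
◂-agree (x ∷ t) {f} {g} p q i r = trans (◂-nth x {x ∷ t} {f} p i r) (sym (◂-nth x {x ∷ t} {g} q i r))

applyUpTo-◂ : ∀ (f : ℕ → A) n → applyUpTo f n ◂ f
applyUpTo-◂ f n = cong (applyUpTo f) (List.length-applyUpTo f n)

applyUpTo-+ : ∀ (f : ℕ → A) m n → applyUpTo f (m + n) ≡ applyUpTo f m ++ applyUpTo (λ i → f (m + i)) n
applyUpTo-+ f zero    n = refl
applyUpTo-+ f (suc m) n = cong (f 0 ∷_) (applyUpTo-+ (f ∘ suc) m n)

applyUpTo-≤ : ∀ (f : ℕ → A) {m n} → m ≤ n → ∃[ r ] applyUpTo f n ≡ applyUpTo f m ++ r
applyUpTo-≤ f {m} {n} m≤n = applyUpTo (λ i → f (m + i)) (n ∸ m) ,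
  trans (cong (applyUpTo f) (sym (m+[n∸m]≡n m≤n))) (applyUpTo-+ f m (n ∸ m))

applyUpTo-cong : ∀ {f g : ℕ → A} n → (∀ i → i < n → f i ≡ g i) → applyUpTo f n ≡ applyUpTo g n
applyUpTo-cong zero    p = refl
applyUpTo-cong {f = f} {g} (suc n) p = cong₂ _∷_ (p 0 z<s) (applyUpTo-cong {f = f ∘ suc} {g ∘ suc} n (λ i q → p (suc i) (s≤s q)))

-- Entry `i` is read off `L (suc i)`, the first list sure to contain it when every step adds an
-- element; `d` only makes `nth` total.
limit : A → (ℕ → List A) → ℕ → A
limit d L i = nth d (L (suc i)) i

module _ (d : A) (L : ℕ → List A) (step : ∀ n → ∃[ x ] ∃[ r ] L (suc n) ≡ L n ++ x ∷ r) where

  chain-+ : ∀ n k → ∃[ r ] L (k + n) ≡ L n ++ r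
  chain-+ n zero = [] , sym (List.++-identityʳ (L n))
  chain-+ n (suc k) with chain-+ n k | step (k + n)
  ... | r , p | x , r′ , q = r ++ x ∷ r′ , trans q (trans (cong (_++ x ∷ r′) p) (List.++-assoc (L n) r (x ∷ r′)))

  chain-≤ : ∀ {m n} → m ≤ n → ∃[ r ] L n ≡ L m ++ r
  chain-≤ {m} {n} m≤n with chain-+ m (n ∸ m)
  ... | r , p = r , trans (cong L (sym (m∸n+n≡m m≤n))) p

  chain-length : ∀ n → n ≤ length (L n)
  chain-length zero = z≤n
  chain-length (suc n) with step n
  ... | x , r , p rewrite p | List.length-++ (L n) {x ∷ r} | +-suc (length (L n)) (length r) =
    s≤s (≤-trans (chain-length n) (m≤m+n _ _))

  chain-◂-limit : ∀ n → L n ◂ limit d L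
  chain-◂-limit n = nth-◂ d (L n) agree
    where
    agree : ∀ i → i < length (L n) → nth d (L (suc i)) i ≡ nth d (L n) i
    agree i i<  with ≤-total (suc i) n
    ... | inj₁ p with chain-≤ p
    ...   | r , q = sym (trans (cong (λ l → nth d l i) q) (nth-++ d (L (suc i)) r i (chain-length (suc i))))
    agree i i< | inj₂ p with chain-≤ p
    ...   | r , q = trans (cong (λ l → nth d l i) q) (nth-++ d (L n) r i i<)

-- Embeddings of the binary tree

-- The embedding property is irrelevant so that ((e ↾ s) ↾ t) and (e ↾ (s ++ t))
-- are definitionally equal as soon as the underlying functions are.
record Cond : Set where
  constructor mkᶜ
  field
    to    : List Bool → List Bool
    .step′ : ∀ s i → to (s ∷ʳ i) ≡ to s ++ i ∷ drop (suc (length (to s))) (to (s ∷ʳ i))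

open Cond public using (to)

private
  split-drop : ∀ (xs : List A) {x r ys} → ys ≡ xs ++ x ∷ r → ys ≡ xs ++ x ∷ drop (suc (length xs)) ys
  split-drop []       refl = refl
  split-drop (y ∷ xs) refl = cong (y ∷_) (split-drop xs refl)

-- The record names the remainder by `drop`, so what is irrelevant there is a mere equation between
-- lists of booleans, and `recompute` recovers it by deciding it.
step : ∀ (e : Cond) s i → ∃[ r ] to e (s ∷ʳ i) ≡ to e s ++ i ∷ r
step (mkᶜ to st) s i = _ , recompute (List.≡-dec Bool._≟_ _ _) (st s i)

mkCond : (f : List Bool → List Bool) → (∀ s i → ∃[ r ] f (s ∷ʳ i) ≡ f s ++ i ∷ r) → Cond
mkCond f h = mkᶜ f (λ s i → split-drop (f s) (proj₂ (h s i)))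

to-++ : ∀ (e : Cond) s r → ∃[ r′ ] to e (s ++ r) ≡ to e s ++ r′
to-++ e s []      = [] , trans (cong (to e) (List.++-identityʳ s)) (sym (List.++-identityʳ _))
to-++ e s (i ∷ r) with step e s i | to-++ e (s ∷ʳ i) r
... | r₁ , p | r₂ , q = i ∷ r₁ ++ r₂ ,
  trans (cong (to e) (sym (List.∷ʳ-++ s i r)))
    (trans q (trans (cong (_++ r₂) p) (List.++-assoc (to e s) (i ∷ r₁) r₂)))

to-∷ : ∀ (e : Cond) s i r → ∃[ r′ ] to e (s ++ i ∷ r) ≡ to e s ++ i ∷ r′
to-∷ e s i r with step e s i | to-++ e (s ∷ʳ i) r
... | r₁ , p | r₂ , q = r₁ ++ r₂ ,
  trans (cong (to e) (sym (List.∷ʳ-++ s i r)))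
    (trans q (trans (cong (_++ r₂) p) (List.++-assoc (to e s) (i ∷ r₁) r₂)))

infixl 7 _↾_
infix 4 _≤ᶜ_

_↾_ : Cond → List Bool → Cond
e ↾ t = mkCond (λ s → to e (t ++ s)) λ s i →
  case step e (t ++ s) i of λ { (r , p) → r , trans (cong (to e) (sym (List.++-assoc t s [ i ]))) p }

idᶜ : Cond
idᶜ = mkCond id (λ s i → [] , refl)

record _≤ᶜ_ (e′ e : Cond) : Set where
  constructor _,_
  field
    factor   : Cond
    factor-≡ : ∀ s → to e′ s ≡ to e (to factor s)

open _≤ᶜ_ public

≤ᶜ-refl : ∀ {e} → e ≤ᶜ e
≤ᶜ-refl = idᶜ , λ s → refl

_∘ᶜ_ : Cond → Cond → Cond
e ∘ᶜ d = mkCond (to e ∘ to d) λ s i →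
  case step d s i of λ { (r , p) → case to-∷ e (to d s) i r of λ { (r′ , q) → r′ , trans (cong (to e) p) q } }

≤ᶜ-trans : ∀ {e₁ e₂ e₃} → e₁ ≤ᶜ e₂ → e₂ ≤ᶜ e₃ → e₁ ≤ᶜ e₃
≤ᶜ-trans (d₁ , p) (d₂ , q) = d₂ ∘ᶜ d₁ , λ s → trans (p s) (q _)

↾-≤ : ∀ e t → e ↾ t ≤ᶜ e
↾-≤ e t = idᶜ ↾ t , λ s → refl

↾-++ : ∀ e s t → e ↾ (s ++ t) ≤ᶜ (e ↾ s) ↾ t
↾-++ e s t = idᶜ , λ r → cong (to e) (List.++-assoc s t r)

-- The values of `d` above `t` all begin with `s`; cancelling `s` from them leaves an embedding,
-- which is the required factor.
↾-mono : ∀ {e e′} ((d , _) : e′ ≤ᶜ e) t s r → to d t ≡ s ++ r → e′ ↾ t ≤ᶜ e ↾ s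
↾-mono {e} {e′} (d , p) t s r q = mkCond to′ step′ , λ u → trans (p (t ++ u)) (cong (to e) (to≡ u))
  where
  tail : List Bool → List Bool
  tail u = proj₁ (to-++ d t u)
  to′ : List Bool → List Bool
  to′ u = r ++ tail u
  to≡ : ∀ u → to d (t ++ u) ≡ s ++ to′ u
  to≡ u = trans (proj₂ (to-++ d t u)) (trans (cong (_++ tail u) q) (List.++-assoc s r (tail u)))
  step′ : ∀ u i → ∃[ v ] to′ (u ∷ʳ i) ≡ to′ u ++ i ∷ v
  step′ u i with step d (t ++ u) i
  ... | v , w = v , List.++-cancelˡ s (to′ (u ∷ʳ i)) (to′ u ++ i ∷ v)
    (trans (sym (to≡ (u ∷ʳ i)))
    (trans (cong (to d) (sym (List.++-assoc t u [ i ])))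
    (trans w (trans (cong (_++ i ∷ v) (to≡ u)) (List.++-assoc s (to′ u) (i ∷ v))))))

to-[]-∷ : ∀ (d : Cond) i → ∃[ j ] ∃[ r ] to d [ i ] ≡ j ∷ r
to-[]-∷ d i with to d [] | step d [] i
... | []    | r , p = i , r , p
... | j ∷ s | r , p = j , s ++ i ∷ r , p

image-step : ∀ (e : Cond) (g : ℕ → Bool) n →
             ∃[ x ] ∃[ r ] to e (applyUpTo g (suc n)) ≡ to e (applyUpTo g n) ++ x ∷ r
image-step e g n = case step e (applyUpTo g n) (g n) of λ { (r , p) →
  g n , r , trans (cong (to e) (sym (List.applyUpTo-∷ʳ g n))) p }

image : Cond → (ℕ → Bool) → ℕ → Bool
image e g = limit false (λ n → to e (applyUpTo g n))

image-◂ : ∀ e g n → to e (applyUpTo g n) ◂ image e g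
image-◂ e g = chain-◂-limit false _ (image-step e g)

image-length : ∀ e g n → n ≤ length (to e (applyUpTo g n))
image-length e g = chain-length false _ (image-step e g)

◂-split : ∀ (t : List A) {f n} → t ◂ f → n ≤ length t → ∃[ r ] t ≡ applyUpTo f n ++ r
◂-split t {f} p q = case applyUpTo-≤ f q of λ { (r , w) → r , trans (sym p) w }

-- Addresses travel along the factor. The image of `n` bits has at least `n` bits, so it extends the
-- first `n` bits of `image d g`, and `↾-mono` applies.
≤ᶜ-image : ∀ {e e′} ((d , _) : e′ ≤ᶜ e) g n → e′ ↾ applyUpTo g n ≤ᶜ e ↾ applyUpTo (image d g) n
≤ᶜ-image {e} {e′} e′≤e@(d , _) g n = case ◂-split _ (image-◂ d g n) (image-length d g n) of λ { (r , p) →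
  ↾-mono {e} {e′} e′≤e (applyUpTo g n) (applyUpTo (image d g) n) r p }

Through : Cond → (ℕ → Bool) → (ℕ → Bool) → Set
Through e g f = ∀ n → to e (applyUpTo g n) ◂ f

infix 4 _∈ᶜ_

_∈ᶜ_ : (ℕ → Bool) → Cond → Set
f ∈ᶜ e = ∃[ g ] Through e g f

∈ᶜ-mono : ∀ {e e′ f} → e′ ≤ᶜ e → f ∈ᶜ e′ → f ∈ᶜ e
∈ᶜ-mono {e} {e′} {f} (d , p) (g , h) = image d g , λ n →
  case ◂-split _ (image-◂ d g n) (image-length d g n) of λ { (r , q) →
  case to-++ e (applyUpTo (image d g) n) r of λ { (r′ , w) →
  ◂-++ˡ _ r′ {f} (subst (_◂ f) (trans (p _) (trans (cong (to e) q) w)) (h n)) } }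

-- Additivity and fusion

∈ᶜ-split : ∀ {e f} → f ∈ᶜ e → ∃[ i ] f ∈ᶜ e ↾ [ i ]
∈ᶜ-split (g , h) = g 0 , g ∘ suc , λ n → h (suc n)

-- Fusion establishes properties at the nodes of a level; this brings them back to the whole
-- condition.
additive : ∀ {ψ} (Ψ : Cond → Set ψ) → (∀ e → (∀ i → Ψ (e ↾ [ i ])) → Ψ e) →
           ∀ n e → (∀ t → length t ≡ n → Ψ (e ↾ t)) → Ψ e
additive Ψ add zero    e h = h [] refl
additive Ψ add (suc n) e h = add e (λ i → additive Ψ add n (e ↾ [ i ]) (λ t p → h (i ∷ t) (cong suc p)))

Refinement : Set
Refinement = Σ[ ρ ∈ (ℕ → Cond → Cond) ] (∀ j e → ρ j e ≤ᶜ e)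

tailᴿ : Refinement → Refinement
tailᴿ (ρ , p) = ρ ∘ suc , p ∘ suc

run : Refinement → Cond → List Bool → Cond
run ρ e []      = e
run ρ e (i ∷ s) = run (tailᴿ ρ) (proj₁ ρ 0 (e ↾ [ i ])) s

dropᴿ : ℕ → Refinement → Refinement
dropᴿ zero    ρ = ρ
dropᴿ (suc n) ρ = dropᴿ n (tailᴿ ρ)

run-++ : ∀ ρ e s t → run ρ e (s ++ t) ≡ run (dropᴿ (length s) ρ) (run ρ e s) t
run-++ ρ e []      t = refl
run-++ ρ e (i ∷ s) t = run-++ (tailᴿ ρ) _ s t

run-∷ʳ : ∀ ρ e s i → run ρ e (s ∷ʳ i) ≡ proj₁ ρ (length s) (run ρ e s ↾ [ i ])
run-∷ʳ ρ e []      i = refl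
run-∷ʳ ρ e (j ∷ s) i = run-∷ʳ (tailᴿ ρ) _ s i

-- The node at `s` is the root of the condition reached by refining along `s`. Each refinement comes
-- after a turn, so both sides of a node still branch off from it.
fuse : Refinement → Cond → Cond
fuse ρ e = mkCond (λ s → to (run ρ e s) []) λ s i →
    case proj₂ ρ (length s) (run ρ e s ↾ [ i ]) of λ { (d , p) →
      case to-∷ (run ρ e s) [] i (to d []) of λ { (r , q) →
      r , trans (cong (λ c → to c []) (run-∷ʳ ρ e s i)) (trans (p []) q) } }

fuse-≤ : ∀ ρ e → fuse ρ e ≤ᶜ e
fuse-≤ ρ e = mkCond (to′ ρ e) (step′ ρ e) , correct ρ e
  where
  d₀ : ∀ ρ e i → Cond
  d₀ ρ e i = factor (proj₂ ρ 0 (e ↾ [ i ]))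
  to′ : ∀ ρ e → List Bool → List Bool
  to′ ρ e []      = []
  to′ ρ e (i ∷ s) = i ∷ to (d₀ ρ e i) (to′ (tailᴿ ρ) (proj₁ ρ 0 (e ↾ [ i ])) s)
  step′ : ∀ ρ e s i → ∃[ r ] to′ ρ e (s ∷ʳ i) ≡ to′ ρ e s ++ i ∷ r
  step′ ρ e []      i = _ , refl
  step′ ρ e (j ∷ s) i with step′ (tailᴿ ρ) (proj₁ ρ 0 (e ↾ [ j ])) s i
  ... | r , p with to-∷ (d₀ ρ e j) (to′ (tailᴿ ρ) (proj₁ ρ 0 (e ↾ [ j ])) s) i r
  ...   | r′ , q = r′ , cong (j ∷_) (trans (cong (to (d₀ ρ e j)) p) q)
  correct : ∀ ρ e s → to (fuse ρ e) s ≡ to e (to′ ρ e s)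
  correct ρ e []      = refl
  correct ρ e (i ∷ s) = trans (correct (tailᴿ ρ) (proj₁ ρ 0 (e ↾ [ i ])) s) (factor-≡ (proj₂ ρ 0 (e ↾ [ i ])) _)

-- Above `t` the fusion is again a fusion: of `run ρ e t`, by the remaining refinements.
fuse-↾-≤ : ∀ ρ e t → fuse ρ e ↾ t ≤ᶜ run ρ e t
fuse-↾-≤ ρ e t = case fuse-≤ (dropᴿ (length t) ρ) (run ρ e t) of λ { (d , p) →
  d , λ s → trans (cong (λ c → to c []) (run-++ ρ e t s)) (p s) }

abstract
  fuse-along : ∀ ρ e → ∃[ e′ ] (e′ ≤ᶜ e × ∀ t → e′ ↾ t ≤ᶜ run ρ e t)
  fuse-along ρ e = fuse ρ e , fuse-≤ ρ e , fuse-↾-≤ ρ e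

≡⇒≤ᶜ : ∀ {e e′} → e ≡ e′ → e ≤ᶜ e′
≡⇒≤ᶜ refl = ≤ᶜ-refl

∘ᶜ-mono : ∀ e {d d′} → d ≤ᶜ d′ → e ∘ᶜ d ≤ᶜ e ∘ᶜ d′
∘ᶜ-mono e (c , p) = c , λ s → cong (to e) (p s)

DownClosed : ∀ {φ} → (Cond → Set φ) → Set φ
DownClosed Φ = ∀ {e e′} → e′ ≤ᶜ e → Φ e → Φ e′

DenseBelow : ∀ {φ} → (Cond → Set φ) → Cond → Set φ
DenseBelow Φ e = ∀ e′ → e′ ≤ᶜ e → ∃[ e″ ] (e″ ≤ᶜ e′ × Φ e″)

length-∷ʳ : ∀ (x : A) xs → length (xs ∷ʳ x) ≡ suc (length xs)
length-∷ʳ x xs = trans (List.length-++ xs) (+-comm (length xs) 1)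

unsnoc : ∀ j (t : List A) → length t ≡ suc j → ∃[ s ] ∃[ i ] (t ≡ s ∷ʳ i × length s ≡ j)
unsnoc j       (i ∷ [])        p = [] , i , refl , suc-injective p
unsnoc (suc j) (i ∷ t@(_ ∷ _)) p with unsnoc j t (suc-injective p)
... | s , k , q , l = i ∷ s , k , cong (i ∷_) q , cong suc l

module _ {φ : Level} (Φ : ℕ → Cond → Set φ) (down : ∀ j → DownClosed (Φ j))
         (e₀ : Cond) (dense : ∀ j → DenseBelow (Φ j) e₀) where

  private
    -- Density is given only below `e₀`, whereas a refinement acts on every condition. Hence it acts
    -- on factors `d`, and `Φ j` is tested at `e₀ ∘ᶜ d`.
    shrink : ∀ j d → ∃[ d′ ] (d′ ≤ᶜ d × Φ j (e₀ ∘ᶜ d′))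
    shrink j d with dense j (e₀ ∘ᶜ d) (d , λ s → refl)
    ... | e′ , (c , p) , x = d ∘ᶜ c , (c , λ s → refl) , down j (idᶜ , λ s → sym (p s)) x

    ρ : Refinement
    ρ = (λ j d → proj₁ (shrink j d)) , λ j d → proj₁ (proj₂ (shrink j d))

    d∞ : ∃[ d ] (d ≤ᶜ idᶜ × ∀ t → d ↾ t ≤ᶜ run ρ idᶜ t)
    d∞ = fuse-along ρ idᶜ

    fused : Cond
    fused = e₀ ∘ᶜ proj₁ d∞

    met-∷ʳ : ∀ s i → Φ (length s) (fused ↾ (s ∷ʳ i))
    met-∷ʳ s i = down _
      (≤ᶜ-trans (∘ᶜ-mono e₀ {proj₁ d∞ ↾ (s ∷ʳ i)} (proj₂ (proj₂ d∞) (s ∷ʳ i)))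
                (≡⇒≤ᶜ (cong (e₀ ∘ᶜ_) (run-∷ʳ ρ idᶜ s i))))
      (proj₂ (proj₂ (shrink _ (run ρ idᶜ s ↾ [ i ]))))

    met : ∀ j t → length t ≡ suc j → Φ j (fused ↾ t)
    met j t l = case unsnoc j t l of λ { (s , i , p , q) →
      subst₂ (λ k u → Φ k (fused ↾ u)) q (sym p) (met-∷ʳ s i) }

  fusion-ℕ : ∃[ e ] (e ≤ᶜ e₀ × ∀ j t → length t ≡ suc j → Φ j (e ↾ t))
  fusion-ℕ = fused , (proj₁ d∞ , λ s → refl) , met

fusion : ∀ {φ} {I : Set} {{_ : Enumerable I}} (Φ : I → Cond → Set φ) → (∀ j → DownClosed (Φ j)) →
         ∀ e₀ → (∀ j → DenseBelow (Φ j) e₀) →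
         ∃[ e ] (e ≤ᶜ e₀ × ∀ j → ∃[ n ] ∀ t → length t ≡ n → Φ j (e ↾ t))
fusion {{E}} Φ down e₀ dense =
  case fusion-ℕ (λ j → Φ (E.enum j)) (λ j → down (E.enum j)) e₀ (λ j → dense (E.enum j)) of λ { (e , e≤ , h) →
  e , e≤ , λ j → suc (proj₁ (E.surjective j)) ,
    λ t l → subst (λ i → Φ i (e ↾ t)) (proj₂ (E.surjective j)) (h _ t l) }
  where module E = Enumerable E

-- Classical logic and least numbers

module Classical (em : ∀ {l} → ExcludedMiddle l) where

  dne : ∀ {p} {P : Set p} → ¬ ¬ P → P
  dne {P = P} h with em {P = P}
  ... | yes p = p
  ... | no ¬p = ⊥-elim (h ¬p)

  ¬∀⇒∃¬ : ∀ {a p} {A : Set a} {P : A → Set p} → ¬ (∀ x → P x) → ∃[ x ] ¬ P x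
  ¬∀⇒∃¬ h = dne λ k → h λ x → dne λ q → k (x , q)

  Least : ∀ {p} → (ℕ → Set p) → ℕ → Set p
  Least P n = P n × (∀ k → P k → n ≤ k)

  least : ∀ {p} {P : ℕ → Set p} n → P n → ∃[ k ] Least P k
  least {P = P} n p = go n 0 (λ k _ → z≤n) (subst P (sym (+-identityʳ n)) p)
    where
    go : ∀ gap m → (∀ k → P k → m ≤ k) → P (gap + m) → ∃[ k ] Least P k
    go zero      m low p = m , p , low
    go (suc gap) m low p with em {P = P m}
    ... | yes q = m , q , low
    ... | no ¬q = go gap (suc m) (λ k r → ≤∧≢⇒< (low k r) (λ { refl → ¬q r })) (subst P (sym (+-suc gap m)) p)

  least-unique : ∀ {p q} {P : ℕ → Set p} {Q : ℕ → Set q} → (∀ {k} → P k → Q k) → (∀ {k} → Q k → P k) →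
                 ∀ {m n} → Least P m → Least Q n → m ≡ n
  least-unique f g (p , lowp) (q , lowq) = ≤-antisym (lowp _ (g q)) (lowq _ (f p))

-- Linear algebra over a countable field

module LinearAlgebra (em : ∀ {l} → ExcludedMiddle l) {c ℓ m ℓm : Level} {F : Field c ℓ}
                     (countable : Countable F) (E : SpaceWithBasis F m ℓm) where

  open Classical em
  open SpaceWithBasis E hiding (module F)
  open BlockSequences E
  private module K = Field F
  private module ≈R = SetoidReasoning ≈ᴹ-setoid
  private module ≈K = SetoidReasoning K.setoid

  coords : ∀ {n} → Vector K.Carrier n → ℕ → K.Carrier
  coords {zero}  a i       = K.0#
  coords {suc n} a zero    = a fzero
  coords {suc n} a (suc i) = coords (a ∘ fsuc) i

  coords-< : ∀ {n} (a : Vector K.Carrier n) {i} (p : i < n) → coords a i ≡ a (fromℕ< p)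
  coords-< {suc n} a {zero}  p       = refl
  coords-< {suc n} a {suc i} (s≤s p) = coords-< (a ∘ fsuc) p

  coords-≥ : ∀ {n} (a : Vector K.Carrier n) {i} → ¬ (i < n) → coords a i ≡ K.0#
  coords-≥ {zero}  a         p = refl
  coords-≥ {suc n} a {zero}  p = ⊥-elim (p z<s)
  coords-≥ {suc n} a {suc i} p = coords-≥ (a ∘ fsuc) (p ∘ s≤s)

  coords-zero : ∀ {n} (a : Vector K.Carrier n) → (∀ i → a i K.≈ K.0#) → ∀ i → coords a i K.≈ K.0#
  coords-zero {zero}  a p i       = K.refl
  coords-zero {suc n} a p zero    = p fzero
  coords-zero {suc n} a p (suc i) = coords-zero (a ∘ fsuc) (p ∘ fsuc) i

  combination-zero : ∀ x {n} (a : Vector K.Carrier n) → (∀ i → coords a i K.≈ K.0#) → combination x a ≈ᴹ 0ᴹ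
  combination-zero x {zero}  a p = ≈ᴹ-refl
  combination-zero x {suc n} a p =
    ≈ᴹ-trans (+ᴹ-cong (≈ᴹ-trans (*ₗ-cong (p 0) ≈ᴹ-refl) (*ₗ-zeroˡ _)) (combination-zero (x ∘ suc) (a ∘ fsuc) (p ∘ suc)))
             (+ᴹ-identityˡ 0ᴹ)

  +ᴹ-interchange : ∀ u v w z → (u +ᴹ v) +ᴹ (w +ᴹ z) ≈ᴹ (u +ᴹ w) +ᴹ (v +ᴹ z)
  +ᴹ-interchange u v w z = begin
    (u +ᴹ v) +ᴹ (w +ᴹ z) ≈⟨ +ᴹ-assoc u v (w +ᴹ z) ⟩
    u +ᴹ (v +ᴹ (w +ᴹ z)) ≈⟨ +ᴹ-congˡ (+ᴹ-assoc v w z) ⟨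
    u +ᴹ ((v +ᴹ w) +ᴹ z) ≈⟨ +ᴹ-congˡ (+ᴹ-congʳ (+ᴹ-comm v w)) ⟩
    u +ᴹ ((w +ᴹ v) +ᴹ z) ≈⟨ +ᴹ-congˡ (+ᴹ-assoc w v z) ⟩
    u +ᴹ (w +ᴹ (v +ᴹ z)) ≈⟨ +ᴹ-assoc u w (v +ᴹ z) ⟨
    (u +ᴹ w) +ᴹ (v +ᴹ z) ∎
    where open ≈R

  infixl 6 _⊕_

  _⊕_ : ∀ {n k} → Vector K.Carrier n → Vector K.Carrier k → Vector K.Carrier (n ⊔ⁿ k)
  _⊕_ {zero}  {k}     a b         = b
  _⊕_ {suc n} {zero}  a b         = a
  _⊕_ {suc n} {suc k} a b fzero    = a fzero K.+ b fzero
  _⊕_ {suc n} {suc k} a b (fsuc i) = ((a ∘ fsuc) ⊕ (b ∘ fsuc)) i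

  combination-⊕ : ∀ x {n k} (a : Vector K.Carrier n) (b : Vector K.Carrier k) →
                  combination x (a ⊕ b) ≈ᴹ combination x a +ᴹ combination x b
  combination-⊕ x {zero}  {k}     a b = ≈ᴹ-sym (+ᴹ-identityˡ _)
  combination-⊕ x {suc n} {zero}  a b = ≈ᴹ-sym (+ᴹ-identityʳ _)
  combination-⊕ x {suc n} {suc k} a b =
    ≈ᴹ-trans (+ᴹ-cong (*ₗ-distribʳ _ _ _) (combination-⊕ (x ∘ suc) (a ∘ fsuc) (b ∘ fsuc)))
             (+ᴹ-interchange _ _ _ _)

  coords-⊕ : ∀ {n k} (a : Vector K.Carrier n) (b : Vector K.Carrier k) i → coords (a ⊕ b) i K.≈ coords a i K.+ coords b i
  coords-⊕ {zero}  {k}     a b i       = K.sym (K.+-identityˡ _)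
  coords-⊕ {suc n} {zero}  a b i       = K.sym (K.+-identityʳ _)
  coords-⊕ {suc n} {suc k} a b zero    = K.refl
  coords-⊕ {suc n} {suc k} a b (suc i) = coords-⊕ (a ∘ fsuc) (b ∘ fsuc) i

  scale : ∀ {n} → K.Carrier → Vector K.Carrier n → Vector K.Carrier n
  scale r a i = r K.* a i

  combination-scale : ∀ x r {n} (a : Vector K.Carrier n) → combination x (scale r a) ≈ᴹ r *ₗ combination x a
  combination-scale x r {zero}  a = ≈ᴹ-sym (*ₗ-zeroʳ r)
  combination-scale x r {suc n} a =
    ≈ᴹ-trans (+ᴹ-cong (*ₗ-assoc _ _ _) (combination-scale (x ∘ suc) r (a ∘ fsuc))) (≈ᴹ-sym (*ₗ-distribˡ _ _ _))

  coords-scale : ∀ r {n} (a : Vector K.Carrier n) i → coords (scale r a) i K.≈ r K.* coords a i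
  coords-scale r {zero}  a i       = K.sym (K.zeroʳ r)
  coords-scale r {suc n} a zero    = K.refl
  coords-scale r {suc n} a (suc i) = coords-scale r (a ∘ fsuc) i

  -- Spans

  record IsSubspace {p} (P : Pred V p) : Set (c ⊔ m ⊔ ℓm ⊔ p) where
    field
      resp  : ∀ {v w} → v ≈ᴹ w → P v → P w
      zero∈ : P 0ᴹ
      plus∈ : ∀ {v w} → P v → P w → P (v +ᴹ w)
      times∈ : ∀ r {v} → P v → P (r *ₗ v)

  open IsSubspace

  ⟨⟩-isSubspace : ∀ x → IsSubspace ⟨ x ⟩
  ⟨⟩-isSubspace x = record
    { resp   = λ { p (n , a , q) → n , a , ≈ᴹ-trans (≈ᴹ-sym p) q }
    ; zero∈  = 0 , (λ ()) , ≈ᴹ-refl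
    ; plus∈  = λ { (_ , a , p) (_ , b , q) → _ , a ⊕ b , ≈ᴹ-trans (+ᴹ-cong p q) (≈ᴹ-sym (combination-⊕ x a b)) }
    ; times∈ = λ { r (_ , a , p) → _ , scale r a , ≈ᴹ-trans (*ₗ-cong K.refl p) (≈ᴹ-sym (combination-scale x r a)) }
    }

  ⟨⟩-least : ∀ {p} {P : Pred V p} → IsSubspace P → ∀ {x} → (∀ k → P (x k)) → ⟨ x ⟩ ⊆ P
  ⟨⟩-least {P = P} S h (n , a , p) = resp S (≈ᴹ-sym p) (go h n a)
    where
    go : ∀ {x} → (∀ k → P (x k)) → ∀ n (a : Vector K.Carrier n) → P (combination x a)
    go h zero    a = zero∈ S
    go h (suc n) a = plus∈ S (times∈ S _ (h 0)) (go (h ∘ suc) n (a ∘ fsuc))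

  ∷-∈⟨⟩ : ∀ x {v w} r → w ∈ ⟨ x ∘ suc ⟩ → v ≈ᴹ r *ₗ x 0 +ᴹ w → v ∈ ⟨ x ⟩
  ∷-∈⟨⟩ x r (n , a , p) q = suc n , (λ { fzero → r ; (fsuc i) → a i }) , ≈ᴹ-trans q (+ᴹ-congˡ p)

  tail-⊆ : ∀ x → ⟨ x ∘ suc ⟩ ⊆ ⟨ x ⟩
  tail-⊆ x {v} p = ∷-∈⟨⟩ x K.0# p (≈ᴹ-sym (≈ᴹ-trans (+ᴹ-congʳ (*ₗ-zeroˡ _)) (+ᴹ-identityˡ v)))

  member : ∀ x k → x k ∈ ⟨ x ⟩
  member x zero    = ∷-∈⟨⟩ x K.1# (zero∈ (⟨⟩-isSubspace (x ∘ suc)))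
    (≈ᴹ-sym (≈ᴹ-trans (+ᴹ-identityʳ _) (*ₗ-identityˡ _)))
  member x (suc k) = tail-⊆ x (member (x ∘ suc) k)

  tails-⊆ : ∀ n x → ⟨ (λ k → x (n + k)) ⟩ ⊆ ⟨ x ⟩
  tails-⊆ n x = ⟨⟩-least (⟨⟩-isSubspace x) {x = λ k → x (n + k)} (λ k → member x (n + k))

  uncons-⟨⟩ : ∀ x {v} → v ∈ ⟨ x ⟩ → ∃[ r ] ∃[ w ] (w ∈ ⟨ x ∘ suc ⟩ × v ≈ᴹ r *ₗ x 0 +ᴹ w)
  uncons-⟨⟩ x {v} (zero  , a , p) = K.0# , 0ᴹ , zero∈ (⟨⟩-isSubspace (x ∘ suc)) ,
    ≈ᴹ-trans p (≈ᴹ-sym (≈ᴹ-trans (+ᴹ-identityʳ _) (*ₗ-zeroˡ _)))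
  uncons-⟨⟩ x (suc n , a , p) = a fzero , _ , (n , a ∘ fsuc , ≈ᴹ-refl) , p

  -- Coefficients

  coeff-coords : ∀ v i → coeff v i ≡ coords (proj₁ (proj₂ (spanning v))) i
  coeff-coords v i with i <? proj₁ (spanning v)
  ... | yes p = sym (coords-< (proj₁ (proj₂ (spanning v))) p)
  ... | no ¬p = sym (coords-≥ (proj₁ (proj₂ (spanning v))) ¬p)

  difference-zero : ∀ {v w} → v ≈ᴹ w → v +ᴹ (K.- K.1#) *ₗ w ≈ᴹ 0ᴹ
  difference-zero {v} {w} p = begin
    v +ᴹ (K.- K.1#) *ₗ w              ≈⟨ +ᴹ-congʳ (≈ᴹ-trans p (≈ᴹ-sym (*ₗ-identityˡ w))) ⟩
    K.1# *ₗ w +ᴹ (K.- K.1#) *ₗ w      ≈⟨ *ₗ-distribʳ w K.1# (K.- K.1#) ⟨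
    (K.1# K.+ K.- K.1#) *ₗ w          ≈⟨ *ₗ-cong (K.-‿inverseʳ K.1#) ≈ᴹ-refl ⟩
    K.0# *ₗ w                         ≈⟨ *ₗ-zeroˡ w ⟩
    0ᴹ                                ∎
    where open ≈R

  difference-zero⁻ : ∀ a b → a K.+ (K.- K.1#) K.* b K.≈ K.0# → a K.≈ b
  difference-zero⁻ a b p = begin
    a                                        ≈⟨ K.+-identityʳ a ⟨
    a K.+ K.0#                               ≈⟨ K.+-congˡ (K.zeroˡ b) ⟨
    a K.+ K.0# K.* b                         ≈⟨ K.+-congˡ (K.*-congʳ (K.-‿inverseˡ K.1#)) ⟨
    a K.+ (K.- K.1# K.+ K.1#) K.* b          ≈⟨ K.+-congˡ (K.distribʳ b _ _) ⟩
    a K.+ ((K.- K.1#) K.* b K.+ K.1# K.* b)  ≈⟨ K.+-assoc _ _ _ ⟨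
    a K.+ (K.- K.1#) K.* b K.+ K.1# K.* b    ≈⟨ K.+-cong p (K.*-identityˡ b) ⟩
    K.0# K.+ b                               ≈⟨ K.+-identityˡ b ⟩
    b                                        ∎
    where open ≈K

  -- The difference of the two expansions is an expansion of zero, so its coefficients vanish by
  -- independence.
  coeff-unique : ∀ {v n} (a : Vector K.Carrier n) → v ≈ᴹ combination e a → ∀ i → coeff v i K.≈ coords a i
  coeff-unique {v} a p i rewrite coeff-coords v i = difference-zero⁻ _ _
    (K.trans (K.sym (K.trans (coords-⊕ b (scale (K.- K.1#) a) i) (K.+-congˡ (coords-scale (K.- K.1#) a i))))
             (coords-zero (b ⊕ scale (K.- K.1#) a) (independent _ zero-combination) i))
    where
    b = proj₁ (proj₂ (spanning v))
    zero-combination : combination e (b ⊕ scale (K.- K.1#) a) ≈ᴹ 0ᴹ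
    zero-combination =
      ≈ᴹ-trans (combination-⊕ e b (scale (K.- K.1#) a))
      (≈ᴹ-trans (+ᴹ-congˡ (combination-scale e (K.- K.1#) a))
      (difference-zero (≈ᴹ-trans (≈ᴹ-sym (proj₂ (proj₂ (spanning v)))) p)))

  private
    expansion : ∀ v → v ≈ᴹ combination e (proj₁ (proj₂ (spanning v)))
    expansion v = proj₂ (proj₂ (spanning v))

  coeff-cong : ∀ {v w} → v ≈ᴹ w → ∀ i → coeff v i K.≈ coeff w i
  coeff-cong {v} {w} p i rewrite coeff-coords w i = coeff-unique (proj₁ (proj₂ (spanning w))) (≈ᴹ-trans p (expansion w)) i

  coeff-+ : ∀ v w i → coeff (v +ᴹ w) i K.≈ coeff v i K.+ coeff w i
  coeff-+ v w i rewrite coeff-coords v i | coeff-coords w i =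
    K.trans (coeff-unique (a ⊕ b) (≈ᴹ-trans (+ᴹ-cong (expansion v) (expansion w)) (≈ᴹ-sym (combination-⊕ e a b))) i)
            (coords-⊕ a b i)
    where a = proj₁ (proj₂ (spanning v)) ; b = proj₁ (proj₂ (spanning w))

  coeff-* : ∀ r v i → coeff (r *ₗ v) i K.≈ r K.* coeff v i
  coeff-* r v i rewrite coeff-coords v i =
    K.trans (coeff-unique (scale r a) (≈ᴹ-trans (*ₗ-cong K.refl (expansion v)) (≈ᴹ-sym (combination-scale e r a))) i)
            (coords-scale r a i)
    where a = proj₁ (proj₂ (spanning v))

  coeff-0 : ∀ i → coeff 0ᴹ i K.≈ K.0#
  coeff-0 i = coeff-unique {n = 0} (λ ()) ≈ᴹ-refl i

  vanishing-isSubspace : ∀ i → IsSubspace (λ v → coeff v i K.≈ K.0#)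
  vanishing-isSubspace i = record
    { resp   = λ p q → K.trans (K.sym (coeff-cong p i)) q
    ; zero∈  = coeff-0 i
    ; plus∈  = λ p q → K.trans (coeff-+ _ _ i) (K.trans (K.+-cong p q) (K.+-identityˡ _))
    ; times∈ = λ r p → K.trans (coeff-* r _ i) (K.trans (K.*-congˡ p) (K.zeroʳ r)) }

  integral : ∀ {a b} → a K.* b K.≈ K.0# → ¬ (b K.≈ K.0#) → a K.≈ K.0#
  integral {a} {b} p b≉0 with K.inverse b b≉0
  ... | b⁻¹ , q = begin
    a                     ≈⟨ K.*-identityʳ a ⟨
    a K.* K.1#            ≈⟨ K.*-congˡ q ⟨
    a K.* (b K.* b⁻¹)     ≈⟨ K.*-assoc a b b⁻¹ ⟨
    a K.* b K.* b⁻¹       ≈⟨ K.*-congʳ p ⟩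
    K.0# K.* b⁻¹          ≈⟨ K.zeroˡ b⁻¹ ⟩
    K.0#                  ∎
    where open ≈K

  -- Supports

  bound : V → ℕ
  bound v = proj₁ (spanning v)

  supp-bound : ∀ v {i} → i ∈ supp v → i < bound v
  supp-bound v {i} p with i <? proj₁ (spanning v) | coeff-coords v i
  ... | yes q | _ = q
  ... | no ¬q | r = ⊥-elim (p (K.reflexive (trans r (coords-≥ (proj₁ (proj₂ (spanning v))) ¬q))))

  supp-cong : ∀ {v w i} → v ≈ᴹ w → i ∈ supp v → i ∈ supp w
  supp-cong p q r = q (K.trans (coeff-cong p _) r)

  NonzeroV-cong : ∀ {v w} → v ≈ᴹ w → NonzeroV v → NonzeroV w
  NonzeroV-cong p q r = q (≈ᴹ-trans p r)

  ≺-cong : ∀ {v v′ w w′} → v ≈ᴹ v′ → w ≈ᴹ w′ → v ≺ w → v′ ≺ w′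
  ≺-cong p q h i∈ j∈ = h (supp-cong (≈ᴹ-sym p) i∈) (supp-cong (≈ᴹ-sym q) j∈)

  <supp-cong : ∀ {n v w} → v ≈ᴹ w → n <supp v → n <supp w
  <supp-cong p h j∈ = h (supp-cong (≈ᴹ-sym p) j∈)

  supp-nonempty : ∀ {v} → NonzeroV v → ∃[ i ] i ∈ supp v
  supp-nonempty {v} p = dne λ h → p (≈ᴹ-trans (expansion v)
    (combination-zero e (proj₁ (proj₂ (spanning v))) λ i → subst (K._≈ K.0#) (coeff-coords v i) (dne λ q → h (i , q))))

  <supp⇒≺ : ∀ {v w N} → bound v ≤ N → N <supp w → v ≺ w
  <supp⇒≺ {v} p q i∈ j∈ = <-≤-trans (supp-bound v i∈) (≤-trans p (<⇒≤ (q j∈)))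

  ≺-trans : ∀ {u v w} → NonzeroV v → u ≺ v → v ≺ w → u ≺ w
  ≺-trans nz p q i∈ j∈ with supp-nonempty nz
  ... | k , k∈ = <-trans (p i∈ k∈) (q k∈ j∈)

  -- Block sequences

  module _ {x : ℕ → V} (isB : IsBlock x) where

    block-≺ : ∀ {i j} → i < j → x i ≺ x j
    block-≺ {i} {suc j} (s≤s i≤j) with m≤n⇒m<n∨m≡n i≤j
    ... | inj₁ i<j  = ≺-trans (proj₁ isB j) (block-≺ i<j) (proj₂ isB j)
    ... | inj₂ refl = proj₂ isB i

    block-<supp : ∀ n {N} → N < n → N <supp x n
    block-<supp (suc n) {N} (s≤s N≤n) j∈ with supp-nonempty (proj₁ isB n)
    ... | i , i∈ with m≤n⇒m<n∨m≡n N≤n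
    ...   | inj₁ N<n  = <-trans (block-<supp n N<n i∈) (proj₂ isB n i∈ j∈)
    ...   | inj₂ refl = ≤-<-trans (index≤ n i∈) (proj₂ isB n i∈ j∈)
      where
      index≤ : ∀ n {i} → i ∈ supp (x n) → n ≤ i
      index≤ zero    _  = z≤n
      index≤ (suc n) i∈ = block-<supp (suc n) ≤-refl i∈

  dropᵇ : ℕ → BlockSeq → BlockSeq
  dropᵇ n Y = record { seq = λ k → seq Y (n + k) ; isBlock = (λ k → proj₁ (isBlock Y) (n + k)) ,
    λ k → block-≺ (isBlock Y) (≤-reflexive (sym (+-suc n k))) }

  dropᵇ-≼ : ∀ n Y → dropᵇ n Y ≼ Y
  dropᵇ-≼ n Y = tails-⊆ n (seq Y)

  -- Take `i` in the support of the first vector. Coordinate `i` vanishes on all later vectors, and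
  -- on `v` once its support lies beyond `i`; hence the first vector has coefficient zero in `v`.
  far-tail : ∀ Y → ∃[ N ] (∀ {v} → v ∈ ⟨ seq Y ⟩ → N <supp v → v ∈ ⟨ seq (dropᵇ 1 Y) ⟩)
  far-tail Y with supp-nonempty (proj₁ (isBlock Y) 0)
  ... | i , i∈ = i , λ {v} p q → case uncons-⟨⟩ (seq Y) p of λ { (r , w , w∈ , v≈) →
    let coeff-v : coeff v i K.≈ K.0#
        coeff-v = dne λ h → <-irrefl refl (q h)
        coeff-w : coeff w i K.≈ K.0#
        coeff-w = ⟨⟩-least (vanishing-isSubspace i)
          {x = seq Y ∘ suc} (λ k → dne λ h → <-irrefl refl (block-≺ (isBlock Y) {0} {suc k} z<s i∈ h)) w∈
        r≈0 : r K.≈ K.0#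
        r≈0 = integral (begin
          r K.* coeff (seq Y 0) i                     ≈⟨ coeff-* r (seq Y 0) i ⟨
          coeff (r *ₗ seq Y 0) i                      ≈⟨ K.+-identityʳ _ ⟨
          coeff (r *ₗ seq Y 0) i K.+ K.0#             ≈⟨ K.+-congˡ coeff-w ⟨
          coeff (r *ₗ seq Y 0) i K.+ coeff w i        ≈⟨ coeff-+ _ _ i ⟨
          coeff (r *ₗ seq Y 0 +ᴹ w) i                 ≈⟨ coeff-cong v≈ i ⟨
          coeff v i                                   ≈⟨ coeff-v ⟩
          K.0#                                        ∎) i∈
    in resp (⟨⟩-isSubspace (seq Y ∘ suc))
         (≈ᴹ-sym (≈ᴹ-trans v≈ (≈ᴹ-trans (+ᴹ-congʳ (≈ᴹ-trans (*ₗ-cong r≈0 ≈ᴹ-refl) (*ₗ-zeroˡ _))) (+ᴹ-identityˡ w)))) w∈ }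
    where open ≈K

  far : ∀ n Y → ∃[ N ] (∀ {v} → v ∈ ⟨ seq Y ⟩ → N <supp v → v ∈ ⟨ seq (dropᵇ n Y) ⟩)
  far zero    Y = 0 , λ p _ → p
  far (suc n) Y with far-tail Y | far n (dropᵇ 1 Y)
  ... | N , f | N′ , g = N ⊔ⁿ N′ , λ p q →
    g (f p (λ j∈ → ≤-<-trans (m≤m⊔n N N′) (q j∈))) (λ j∈ → ≤-<-trans (m≤n⊔m N N′) (q j∈))

  -- A number thus does the work of a subspace: vectors of `Y` played beyond `N` are in `X`
  -- automatically.
  ≼*-far : ∀ {Y X} → Y ≼* X → ∃[ N ] (∀ {v} → v ∈ ⟨ seq Y ⟩ → N <supp v → v ∈ ⟨ seq X ⟩)
  ≼*-far {Y} (n , p) with far n Y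
  ... | N , f = N , λ q r → p (f q r)

  ≼*-tail : ∀ {Y X Z} → Y ≼* X → Z ≼ Y → ∃[ n ] dropᵇ n Z ≼ X
  ≼*-tail {Y} {X} {Z} p Z≼Y with ≼*-far {Y} {X} p
  ... | N , f = suc N , ⟨⟩-least (⟨⟩-isSubspace (seq X)) {x = λ k → seq Z (suc N + k)} λ k →
    f (Z≼Y (member (seq Z) (suc N + k))) (block-<supp (isBlock Z) (suc N + k) (s≤s (m≤m+n N k)))

  ≼⇒≼* : ∀ {Y X} → Y ≼ X → Y ≼* X
  ≼⇒≼* p = 0 , p

  ≼-≼*-trans : ∀ {Z Y X} → Z ≼ Y → Y ≼* X → Z ≼* X
  ≼-≼*-trans {Z} {Y} {X} p q = ≼*-tail {Y} {X} {Z} q p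

  ≼*-trans : ∀ {Z Y X} → Z ≼* Y → Y ≼* X → Z ≼* X
  ≼*-trans {Z} {Y} {X} (k , p) q with ≼*-tail {Y} {X} {dropᵇ k Z} q p
  ... | n , r = k + n , λ v∈ → r (⟨⟩-least (⟨⟩-isSubspace (λ i → seq Z (k + (n + i))))
    {x = λ j → seq Z (k + n + j)} (λ j → subst (λ i → seq Z i ∈ ⟨ (λ i → seq Z (k + (n + i))) ⟩) (sym (+-assoc k n j))
      (member (λ i → seq Z (k + (n + i))) j)) v∈)

  -- Codes of vectors

  private
    scalar : ℕ → K.Carrier
    scalar = Surjection.to countable

    combineL : (ℕ → V) → List ℕ → V
    combineL x []      = 0ᴹ
    combineL x (k ∷ l) = scalar k *ₗ x 0 +ᴹ combineL (x ∘ suc) l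

    combineL-surjective : ∀ x {n} (a : Vector K.Carrier n) → ∃[ l ] combineL x l ≈ᴹ combination x a
    combineL-surjective x {zero}  a = [] , ≈ᴹ-refl
    combineL-surjective x {suc n} a with combineL-surjective (x ∘ suc) (a ∘ fsuc) | Surjection.strictlySurjective countable (a fzero)
    ... | l , p | k , q = k ∷ l , +ᴹ-cong (*ₗ-cong q ≈ᴹ-refl) p

  abstract

    vec : ℕ → V
    vec n = combineL e (enum n)

    private
      hasCode : ∀ v → ∃[ n ] vec n ≈ᴹ v
      hasCode v with combineL-surjective e (proj₁ (proj₂ (spanning v)))
      ... | l , p with surjective l
      ...   | n , refl = n , ≈ᴹ-trans p (≈ᴹ-sym (expansion v))

      leastCode : ∀ v → ∃[ n ] Least (λ n → vec n ≈ᴹ v) n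
      leastCode v = least (proj₁ (hasCode v)) (proj₂ (hasCode v))

    -- Taking the least code makes it invariant under `_≈ᴹ_`, so that positions become lists of
    -- numbers compared by `_≡_`.
    code : V → ℕ
    code v = proj₁ (leastCode v)

    vec-code : ∀ v → vec (code v) ≈ᴹ v
    vec-code v = proj₁ (proj₂ (leastCode v))

    code-cong : ∀ {v w} → v ≈ᴹ w → code v ≡ code w
    code-cong {v} {w} p = least-unique (λ q → ≈ᴹ-trans q p) (λ q → ≈ᴹ-trans q (≈ᴹ-sym p))
                                       (proj₂ (leastCode v)) (proj₂ (leastCode w))

    code-injective : ∀ {v w} → code v ≡ code w → v ≈ᴹ w
    code-injective {v} {w} p = ≈ᴹ-trans (≈ᴹ-sym (vec-code v)) (subst (λ k → vec k ≈ᴹ w) (sym p) (vec-code w))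

-- Propositions at the lowest level

module Small (em : ∀ {l} → ExcludedMiddle l) where

  -- Subsets handed to `Full` and bases of Suslin representations live at level zero; the properties
  -- that define them do not.
  Small : ∀ {l} → Set l → Set
  Small P with em {P = P}
  ... | yes _ = ⊤
  ... | no  _ = ⊥

  small : ∀ {l} {P : Set l} → P → Small P
  small {P = P} p with em {P = P}
  ... | yes _ = tt
  ... | no ¬p = ¬p p

  unsmall : ∀ {l} {P : Set l} → Small P → P
  unsmall {P = P} s with em {P = P}
  ... | yes p = p

-- Coded positions and strategies for player II

module Games (em : ∀ {l} → ExcludedMiddle l) {c ℓ m ℓm : Level} {F : Field c ℓ}
             (countable : Countable F) (E : SpaceWithBasis F m ℓm) where

  open Classical em
  open LinearAlgebra em countable E
  open SpaceWithBasis E hiding (module F)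
  open BlockSequences E

  ≋⇒⊆ : ∀ {x y} → x ≋ y → ⟨ x ⟩ ⊆ ⟨ y ⟩
  ≋⇒⊆ {x} {y} p = ⟨⟩-least (⟨⟩-isSubspace y) {x = x} λ k → IsSubspace.resp (⟨⟩-isSubspace y) (≈ᴹ-sym (p k)) (member y k)

  -- The first component admits only least codes, so equal vectors are always played under the same
  -- number.
  Fresh : List ℕ → ℕ → Set (ℓ ⊔ ℓm)
  Fresh p k = code (vec k) ≡ k × NonzeroV (vec k) × All (λ j → vec j ≺ vec k) p

  bounds : List ℕ → ℕ
  bounds []      = 0
  bounds (k ∷ p) = bound (vec k) ⊔ⁿ bounds p

  <supp⇒Fresh : ∀ p {v} → NonzeroV v → bounds p <supp v → Fresh p (code v)
  <supp⇒Fresh p {v} nz q = code-cong (vec-code v) , NonzeroV-cong (≈ᴹ-sym (vec-code v)) nz , go p ≤-refl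
    where
    go : ∀ r → bounds r ≤ bounds p → All (λ j → vec j ≺ vec (code v)) r
    go []      _ = []
    go (k ∷ r) b = ≺-cong ≈ᴹ-refl (≈ᴹ-sym (vec-code v)) (<supp⇒≺ (≤-trans (m≤m⊔n _ _) b) q) ∷ go r (≤-trans (m≤n⊔m _ _) b)

  fresh-member : ∀ (Z : BlockSeq) p N → ∃[ k ] (N <supp seq Z k × Fresh p (code (seq Z k)))
  fresh-member Z p N = suc (N ⊔ⁿ bounds p) ,
    block-<supp (isBlock Z) _ (s≤s (m≤m⊔n N (bounds p))) ,
    <supp⇒Fresh p (proj₁ (isBlock Z) _) (block-<supp (isBlock Z) _ (s≤s (m≤n⊔m N (bounds p))))

  codes : (ℕ → V) → ℕ → List ℕ
  codes z n = applyUpTo (code ∘ z) n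

  -- A tree of finite sequences in which every Z ≼ X offers a continuation is turned into
  -- a strategy that plays continuations of least code, so as to respect ≋.
  module Builder {t : Level} (x : FinBlockSeq) (X : BlockSeq) (T : List ℕ → Set t) (root : T [])
                 (next : ∀ h → T h → ∀ Z → Z ≼ X →
                         ∃[ k ] (vec k ∈ ⟨ seq Z ⟩ × Fresh (map code (entries x) ++ h) k × T (h ∷ʳ k))) where

    private
      x̂ : List ℕ
      x̂ = map code (entries x)

      Legal : List ℕ → BlockSeq → ℕ → Set _
      Legal h Z k = vec k ∈ ⟨ seq Z ⟩ × Fresh (x̂ ++ h) k × T (h ∷ʳ k)

      choice : ∀ {p} {P : ℕ → Set p} → Dec (∃[ k ] Least P k) → ℕ
      choice (yes (k , _)) = k
      choice (no _)        = 0

      choice-correct : ∀ {p} {P : ℕ → Set p} (d : Dec (∃[ k ] Least P k)) → ∃[ k ] P k → P (choice d)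
      choice-correct (yes (k , p , _)) _       = p
      choice-correct (no ¬p)           (k , p) = ⊥-elim (¬p (least k p))

      choice-cong : ∀ {p} {P Q : ℕ → Set p} (d : Dec (∃[ k ] Least P k)) (d′ : Dec (∃[ k ] Least Q k)) →
                    (∀ {k} → P k → Q k) → (∀ {k} → Q k → P k) → choice d ≡ choice d′
      choice-cong (yes (k , p)) (yes (k′ , q)) f g = least-unique f g p q
      choice-cong (yes (k , p)) (no ¬q)        f g = ⊥-elim (¬q (least k (f (proj₁ p))))
      choice-cong (no ¬p)       (yes (k , q))  f g = ⊥-elim (¬p (least k (g (proj₁ q))))
      choice-cong (no _)        (no _)         f g = refl

      abstract
        choose : List ℕ → BlockSeq → ℕ
        choose h Z = choice (em {P = ∃[ k ] Least (Legal h Z) k})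

        choose-legal : ∀ h → T h → ∀ Z → Z ≼ X → Legal h Z (choose h Z)
        choose-legal h τ Z p = choice-correct em (next h τ Z p)

        choose-cong : ∀ h {Z Z′} → seq Z ≋ seq Z′ → choose h Z ≡ choose h Z′
        choose-cong h {Z} {Z′} p = choice-cong em em
          (λ (v∈ , q) → ≋⇒⊆ {seq Z} {seq Z′} p v∈ , q)
          (λ (v∈ , q) → ≋⇒⊆ {seq Z′} {seq Z} (λ n → ≈ᴹ-sym (p n)) v∈ , q)

      play : List ℕ → List BlockSeq → ℕ
      play h []            = 0
      play h (Z ∷ [])      = choose h Z
      play h (Z ∷ Y ∷ Zs)  = play (h ∷ʳ choose h Z) (Y ∷ Zs)

      play-cong : ∀ h {Ys Zs} → Pointwise (λ Y Z → seq Y ≋ seq Z) Ys Zs → play h Ys ≡ play h Zs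
      play-cong h []           = refl
      play-cong h {Y ∷ []} {Z ∷ []} (p ∷ [])     = choose-cong h {Y} {Z} p
      play-cong h {Y ∷ Y′ ∷ Ys} {Z ∷ Z′ ∷ Zs} (p ∷ q ∷ ps) =
        trans (cong (λ k → play (h ∷ʳ k) (Y′ ∷ Ys)) (choose-cong h {Y} {Z} p)) (play-cong (h ∷ʳ choose h Z) (q ∷ ps))

      history : List ℕ → (ℕ → BlockSeq) → ℕ → List ℕ
      history h Y zero    = h
      history h Y (suc k) = history (h ∷ʳ choose h (Y 0)) (Y ∘ suc) k

      play-history : ∀ h Y k → play h (applyUpTo Y (suc k)) ≡ choose (history h Y k) (Y k)
      play-history h Y zero    = refl
      play-history h Y (suc k) = play-history (h ∷ʳ choose h (Y 0)) (Y ∘ suc) k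

      history-suc : ∀ h Y k → history h Y (suc k) ≡ history h Y k ∷ʳ choose (history h Y k) (Y k)
      history-suc h Y zero    = refl
      history-suc h Y (suc k) = history-suc (h ∷ʳ choose h (Y 0)) (Y ∘ suc) k

      played : (ℕ → BlockSeq) → ℕ → ℕ
      played Y k = play [] (applyUpTo Y (suc k))

      history-played : ∀ Y k → history [] Y k ≡ applyUpTo (played Y) k
      history-played Y zero    = refl
      history-played Y (suc k) = trans (history-suc [] Y k)
        (trans (cong₂ _∷ʳ_ (history-played Y k) (sym (play-history [] Y k))) (List.applyUpTo-∷ʳ (played Y) k))

      module Run (Y : ℕ → BlockSeq) (Y≼ : ∀ k → Y k ≼ X) where

        reach : ∀ k → T (history [] Y k)
        reach zero    = root
        reach (suc k) = subst T (sym (history-suc [] Y k)) (proj₂ (proj₂ (choose-legal _ (reach k) (Y k) (Y≼ k))))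

        reached : ∀ k → T (applyUpTo (played Y) k)
        reached k = subst T (history-played Y k) (reach k)

        legal : ∀ k → Legal (applyUpTo (played Y) k) (Y k) (played Y k)
        legal k = subst₂ (λ h → Legal h (Y k)) (history-played Y k) (sym (play-history [] Y k))
                         (choose-legal _ (reach k) (Y k) (Y≼ k))

        fresh : ∀ k → Fresh (x̂ ++ applyUpTo (played Y) k) (played Y k)
        fresh k = proj₁ (proj₂ (legal k))

    strategy : StrategyII x X
    strategy = record
      { move  = λ Ys → vec (play [] Ys)
      ; cong  = λ p → ≈ᴹ-reflexive (cong vec (play-cong [] p))
      ; legal = λ Y Y≼ → let open Run Y Y≼ in
          ( (λ k → proj₁ (proj₂ (fresh k)))
          , λ k → All.applyUpTo⁻ (played Y) (suc k) (All.++⁻ʳ x̂ (proj₂ (proj₂ (fresh (suc k))))) ≤-refl)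
          , (λ k → All.map (λ {v} → ≺-cong (vec-code v) ≈ᴹ-refl) (All.map⁻ (All.++⁻ˡ x̂ (proj₂ (proj₂ (fresh k))))))
          , (λ k → proj₁ (legal k))
      }

    outcome-branch : ∀ Z → Z ∈ OutcomesII strategy →
                     ∃[ b ] ((∀ k → T (applyUpTo b k)) × (∀ k → code (vec (b k)) ≡ b k) × seq Z ≋ (entries x ⌢ (vec ∘ b)))
    outcome-branch Z (Y , Y≼ , p) = played Y , Run.reached Y Y≼ , (λ k → proj₁ (Run.fresh Y Y≼ k)) , p

-- Diagonalisation in the filter

module Filters (em : ∀ {l} → ExcludedMiddle l) {c ℓ m ℓm u : Level} {F : Field c ℓ}
               (countable : Countable F) (E : SpaceWithBasis F m ℓm)
               (U : Pred (BlockSequences.BlockSeq E) u) (isP⁺ : BlockSequences.IsP⁺Filter E U) where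

  open Classical em
  open LinearAlgebra em countable E
  open BlockSequences E
  open IsP⁺Filter isP⁺
  open IsFilter isFilter
  open IsFamily isFamily

  𝕌 : Set (m ⊔ ℓ ⊔ ℓm ⊔ u)
  𝕌 = Σ BlockSeq U

  someᵁ : 𝕌
  someᵁ = nonempty

  infixl 6 _∧ᵁ_

  abstract
    _∧ᵁ_ : 𝕌 → 𝕌 → 𝕌
    (X , X∈) ∧ᵁ (Y , Y∈) with lowerBound X∈ Y∈
    ... | Z , Z∈ , _ = Z , Z∈

    ∧ᵁ-≼ˡ : ∀ X Y → proj₁ (X ∧ᵁ Y) ≼ proj₁ X
    ∧ᵁ-≼ˡ (X , X∈) (Y , Y∈) with lowerBound X∈ Y∈
    ... | Z , Z∈ , p , _ = p

    ∧ᵁ-≼ʳ : ∀ X Y → proj₁ (X ∧ᵁ Y) ≼ proj₁ Y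
    ∧ᵁ-≼ʳ (X , X∈) (Y , Y∈) with lowerBound X∈ Y∈
    ... | Z , Z∈ , _ , p = p

  meets : (ℕ → 𝕌) → ℕ → 𝕌
  meets Y zero    = someᵁ
  meets Y (suc n) = Y n ∧ᵁ meets Y n

  meets-≼ : ∀ Y {k n} → k < n → proj₁ (meets Y n) ≼ proj₁ (Y k)
  meets-≼ Y {k} {suc n} (s≤s k≤n) with m≤n⇒m<n∨m≡n k≤n
  ... | inj₁ k<n  = λ v∈ → meets-≼ Y k<n (∧ᵁ-≼ʳ (Y n) (meets Y n) v∈)
  ... | inj₂ refl = ∧ᵁ-≼ˡ (Y n) (meets Y n)

  private
    running-meet : 𝕌 → (ℕ → 𝕌) → ℕ → 𝕌
    running-meet X Y zero    = X
    running-meet X Y (suc n) = running-meet X Y n ∧ᵁ Y n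

  abstract
    -- Property `(p)` applies to the decreasing finite meets. A tail of the result is `≼` the zeroth
    -- meet, which is `X`, and it stays in `U` by upward closure.
    diagonal-ℕ : (X : 𝕌) (Y : ℕ → 𝕌) → Σ[ Z ∈ 𝕌 ] (proj₁ Z ≼ proj₁ X × ∀ n → proj₁ Z ≼* proj₁ (Y n))
    diagonal-ℕ X Y = pass-to-tail (propertyP (proj₁ ∘ W) (proj₂ ∘ W) (λ n → ∧ᵁ-≼ˡ (W n) (Y n)))
      where
      W : ℕ → 𝕌
      W = running-meet X Y
      pass-to-tail : Σ[ Z ∈ BlockSeq ] (U Z × ∀ n → Z ≼* proj₁ (W n)) →
                     Σ[ Z ∈ 𝕌 ] (proj₁ Z ≼ proj₁ X × ∀ n → proj₁ Z ≼* proj₁ (Y n))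
      pass-to-tail (Z , Z∈ , p) = (dropᵇ n Z , upwardClosed Z∈ (n , id)) , proj₂ (p 0) , λ k →
        ≼-≼*-trans {dropᵇ n Z} {Z} {proj₁ (Y k)} (dropᵇ-≼ n Z)
          (≼*-trans {Z} {proj₁ (W (suc k))} {proj₁ (Y k)} (p (suc k))
            (≼⇒≼* {proj₁ (W (suc k))} {proj₁ (Y k)} (∧ᵁ-≼ʳ (W k) (Y k))))
        where
        n : ℕ
        n = proj₁ (p 0)

  diagonal : {I : Set} {{_ : Enumerable I}} (X : 𝕌) (Y : I → 𝕌) →
             Σ[ Z ∈ 𝕌 ] (proj₁ Z ≼ proj₁ X × ∀ i → proj₁ Z ≼* proj₁ (Y i))
  diagonal {{N}} X Y = proj₁ Z , proj₁ (proj₂ Z) , λ i →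
    subst (λ j → proj₁ (proj₁ Z) ≼* proj₁ (Y j)) (proj₂ (Enumerable.surjective N i))
          (proj₂ (proj₂ Z) (proj₁ (Enumerable.surjective N i)))
    where Z = diagonal-ℕ X (Y ∘ Enumerable.enum N)

  uniform : ∀ {p} (P : List Bool → 𝕌 → Set p) → (∀ t {X Y} → proj₁ Y ≼ proj₁ X → P t X → P t Y) →
            ∀ n → (∀ t → length t ≡ n → Σ 𝕌 (P t)) → Σ[ Y ∈ 𝕌 ] (∀ t → length t ≡ n → P t Y)
  uniform P mono zero    h with h [] refl
  ... | Y , p = Y , λ { [] _ → p }
  uniform P mono (suc n) h
    with uniform (P ∘ (false ∷_)) (λ t → mono (false ∷ t)) n (λ t l → h (false ∷ t) (cong suc l))
       | uniform (P ∘ (true ∷_)) (λ t → mono (true ∷ t)) n (λ t l → h (true ∷ t) (cong suc l))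
  ... | X , p | Y , q = X ∧ᵁ Y ,
    λ { (false ∷ t) l → mono (false ∷ t) (∧ᵁ-≼ˡ X Y) (p t (suc-injective l))
      ; (true  ∷ t) l → mono (true ∷ t) (∧ᵁ-≼ʳ X Y) (q t (suc-injective l)) }

-- Deciding properties below a condition

applyUpTo-↾⁻ : ∀ e g n k → e ↾ applyUpTo g (n + k) ≤ᶜ e ↾ applyUpTo g n ↾ applyUpTo (λ i → g (n + i)) k
applyUpTo-↾⁻ e g n k rewrite applyUpTo-+ g n k = ↾-++ e (applyUpTo g n) _

-- If the root of the factor is empty, `j` is `false`; otherwise `e′` lies wholly on one side of
-- `e`, and `j` is that side.
≤ᶜ-half : ∀ {e e′} → e′ ≤ᶜ e → ∃[ j ] e′ ↾ [ false ] ≤ᶜ e ↾ [ j ]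
≤ᶜ-half e′≤e = case to-[]-∷ (factor e′≤e) false of λ { (j , r , p) → j , ↾-mono e′≤e [ false ] [ j ] r p }

-- The forcing relation for the negation of `Φ`.
Never : ∀ {φ} → (Cond → Set φ) → Cond → Set φ
Never Φ e = ∀ e′ → e′ ≤ᶜ e → ¬ Φ e′

never-down : ∀ {φ} (Φ : Cond → Set φ) → DownClosed (Never Φ)
never-down Φ p h e′ q = h e′ (≤ᶜ-trans q p)

never-additive : ∀ {φ} (Φ : Cond → Set φ) → DownClosed Φ → ∀ e → (∀ i → Never Φ (e ↾ [ i ])) → Never Φ e
never-additive Φ down e h e′ p x = case ≤ᶜ-half p of λ { (j , q) → h j (e′ ↾ [ false ]) q (down (↾-≤ e′ [ false ]) x) }

module Deciding (em : ∀ {l} → ExcludedMiddle l) where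

  Decided : ∀ {φ} → (Cond → Set φ) → Cond → Set φ
  Decided Φ e = Φ e ⊎ Never Φ e

  decided-down : ∀ {φ} (Φ : Cond → Set φ) → DownClosed Φ → DownClosed (Decided Φ)
  decided-down Φ down p (inj₁ x) = inj₁ (down p x)
  decided-down Φ down p (inj₂ x) = inj₂ (never-down Φ p x)

  decided-dense : ∀ {φ} (Φ : Cond → Set φ) e → ∃[ e′ ] (e′ ≤ᶜ e × Decided Φ e′)
  decided-dense Φ e with em {P = ∃[ e′ ] (e′ ≤ᶜ e × Φ e′)}
  ... | yes (e′ , p , x) = e′ , p , inj₁ x
  ... | no h             = e , ≤ᶜ-refl , inj₂ λ e′ p x → h (e′ , p , x)

  decide-all : ∀ {φ} {I : Set} {{_ : Enumerable I}} (Φ : I → Cond → Set φ) → (∀ j → DownClosed (Φ j)) →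
               ∀ e₀ → ∃[ e ] (e ≤ᶜ e₀ × ∀ j → ∃[ n ] ∀ t → length t ≡ n → Decided (Φ j) (e ↾ t))
  decide-all Φ down e₀ = fusion (λ j → Decided (Φ j)) (λ j → decided-down (Φ j) (down j)) e₀
                                (λ j e′ _ → decided-dense (Φ j) e′)

-- Fusion along a finite sequence h, whose entries steer the refinements.
Steering : Set
Steering = List ℕ → ℕ → (e : Cond) → ∃[ e′ ] e′ ≤ᶜ e

steer : Steering → Cond → List ℕ → List Bool → Cond
steer r e (k ∷ h) (i ∷ t) = steer (r ∘ (k ∷_)) (proj₁ (r [] k (e ↾ [ i ]))) h t
steer r e _       _       = e

steer-∷ʳ : ∀ r e h k t i → length t ≡ length h →
           steer r e (h ∷ʳ k) (t ∷ʳ i) ≡ proj₁ (r h k (steer r e h t ↾ [ i ]))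
steer-∷ʳ r e []      k []      i l = refl
steer-∷ʳ r e (j ∷ h) k (i′ ∷ t) i l = steer-∷ʳ (r ∘ (j ∷_)) _ h k t i (suc-injective l)

steered : Steering → (ℕ → ℕ) → Refinement
steered r b = (λ j e → proj₁ (r (applyUpTo b j) (b j) e)) , (λ j e → proj₂ (r (applyUpTo b j) (b j) e))

-- During a play only finite parts of `b` are known. Once the play is over, the conditions prepared
-- along them are the stages of one fusion.
run-steered : ∀ r b e t → run (steered r b) e t ≡ steer r e (applyUpTo b (length t)) t
run-steered r b e []      = refl
run-steered r b e (i ∷ t) = run-steered (r ∘ (b 0 ∷_)) (b ∘ suc) _ t

-- Spans of concatenated sequences

module Spread (em : ∀ {l} → ExcludedMiddle l) {c ℓ m ℓm : Level} {F : Field c ℓ}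
              (countable : Countable F) (E : SpaceWithBasis F m ℓm) where

  open LinearAlgebra em countable E
  open SpaceWithBasis E hiding (module F)
  open BlockSequences E

  ⌢-all : ∀ {p} {P : Pred V p} {vs z} → All P vs → (∀ k → P (z k)) → ∀ k → P ((vs ⌢ z) k)
  ⌢-all []       q k       = q k
  ⌢-all (p ∷ ps) q zero    = p
  ⌢-all (p ∷ ps) q (suc k) = ⌢-all ps q k

  ⌢-membersˡ : ∀ vs z → All (_∈ ⟨ vs ⌢ z ⟩) vs
  ⌢-membersˡ []       z = []
  ⌢-membersˡ (v ∷ vs) z = member ((v ∷ vs) ⌢ z) 0 ∷ All.map (tail-⊆ ((v ∷ vs) ⌢ z)) (⌢-membersˡ vs z)

  ⌢-membersʳ : ∀ vs z k → z k ∈ ⟨ vs ⌢ z ⟩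
  ⌢-membersʳ []       z k = member z k
  ⌢-membersʳ (v ∷ vs) z k = tail-⊆ ((v ∷ vs) ⌢ z) (⌢-membersʳ vs z k)

  ⟨⌢⟩-⊆ : ∀ {vs z ws y} → All (_∈ ⟨ ws ⌢ y ⟩) vs → (∀ k → z k ∈ ⟨ y ⟩) → ⟨ vs ⌢ z ⟩ ⊆ ⟨ ws ⌢ y ⟩
  ⟨⌢⟩-⊆ {vs} {z} {ws} {y} p q = ⟨⟩-least (⟨⟩-isSubspace (ws ⌢ y)) {x = vs ⌢ z}
    (⌢-all p λ k → ⟨⟩-least (⟨⟩-isSubspace (ws ⌢ y)) {x = y} (⌢-membersʳ ws y) (q k))

  combination-agree : ∀ {x y} {n} (a : Vector _ n) → (∀ i → i < n → x i ≈ᴹ y i) →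
                      combination x a ≈ᴹ combination y a
  combination-agree {n = zero}  a p = ≈ᴹ-refl
  combination-agree {n = suc n} a p =
    +ᴹ-cong (*ₗ-congˡ (p 0 z<s)) (combination-agree (a ∘ fsuc) (λ i q → p (suc i) (s≤s q)))

  ⌢-agree : ∀ (y z : ℕ → V) n i → i < n → (applyUpTo y n ⌢ z) i ≡ y i
  ⌢-agree y z (suc n) zero    p       = refl
  ⌢-agree y z (suc n) (suc i) (s≤s p) = ⌢-agree (y ∘ suc) z n i p

  -- A combination uses finitely many terms, so membership is already settled at a finite stage of a
  -- play, whatever follows.
  ⟨⟩-finite : ∀ {y v} → v ∈ ⟨ y ⟩ → ∃[ n ] ∀ z → v ∈ ⟨ applyUpTo y n ⌢ z ⟩
  ⟨⟩-finite {y} (n , a , p) = n , λ z → n , a ,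
    ≈ᴹ-trans p (combination-agree a λ i q → ≈ᴹ-reflexive (sym (⌢-agree y z n i q)))

-- D is a name for a subset of E: D e k says that the vector coded by k belongs to the sets
-- attached to the branches of e.  To obtain (U being strategic) a member of U that avoids D,
-- II plays so as to build, along with the outcome y, a fusion of conditions below which the
-- spans of the initial segments of y avoid D.
module Fullness (em : ∀ {l} → ExcludedMiddle l) {c ℓ m ℓm u : Level} {F : Field c ℓ}
                (countable : Countable F) (E : SpaceWithBasis F m ℓm)
                (U : Pred (BlockSequences.BlockSeq E) u) (isP⁺ : BlockSequences.IsP⁺Filter E U)
                (strategic : BlockSequences.Strategic E U)
                {δ : Level} (D : Cond → ℕ → Set δ) (D-down : ∀ k → DownClosed (λ e → D e k)) where

  open Classical em
  open Small em
  open LinearAlgebra em countable E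
  open SpaceWithBasis E hiding (module F; e)
  open BlockSequences E hiding (_↾_)
  open Games em countable E
  open Filters em countable E U isP⁺
  open Deciding em
  open Spread em countable E
  open IsP⁺Filter isP⁺

  -- `g` is the address of a branch, and `D` at a node of `g` puts the vector into the set attached
  -- to that branch. The span includes the past moves `h` because the whole outcome of the play has
  -- to avoid `D`.
  Meets : 𝕌 → List ℕ → Cond → Set (c ⊔ ℓ ⊔ m ⊔ ℓm ⊔ δ)
  Meets (Y , _) h e = ∀ g Z → Z ≼ Y →
    ∃[ k ] (vec k ∈ ⟨ map vec h ⌢ seq Z ⟩ × ∃[ n ] D (e ↾ applyUpTo g n) k)

  Meeting : List ℕ → Cond → Set (c ⊔ ℓ ⊔ m ⊔ ℓm ⊔ δ ⊔ u)
  Meeting h e = Σ[ Y ∈ 𝕌 ] Meets Y h e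

  Avoidable : List ℕ → Cond → Set (c ⊔ ℓ ⊔ m ⊔ ℓm ⊔ δ ⊔ u)
  Avoidable h = Never (Meeting h)

  meeting-down : ∀ h → DownClosed (Meeting h)
  meeting-down h {e} {e′} e′≤e (Y , μ) = Y , λ g Z Z≼Y →
    case μ (image (factor e′≤e) g) Z Z≼Y of λ { (k , k∈ , n , d) → k , k∈ , n , D-down k (≤ᶜ-image e′≤e g n) d }

  -- Otherwise `Y∞`, which diagonalises the subspaces witnessing `Meeting (h ∷ʳ k)`, would witness
  -- `Meeting h`. Indeed, suppose `Z ≼ Y∞` misses `D` along `g`. No `v` in its span can lead to a
  -- meeting, since the vector met would lie in the span of `h`, `v` and a tail of `Z`, hence of `h`
  -- and `Z`. Such a `Z` is therefore as required.
  avoid-extension : ∀ h e → Avoidable h e → ∀ Y → U Y →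
    Σ[ Z ∈ BlockSeq ] (Z ≼ Y × (∀ {v} → v ∈ ⟨ seq Z ⟩ → ∃[ e′ ] (e′ ≤ᶜ e × Avoidable (h ∷ʳ code v) e′)))
  avoid-extension h e avoid Y Y∈ = dne λ none → avoid e₁ e₁≤ (Y∞ , λ g Z Z≼Y∞ → dne λ miss →
      none (Z , (λ v∈ → proj₁ (proj₂ below) (Z≼Y∞ v∈)) , λ v∈ → extends g Z Z≼Y∞ miss v∈))
    where
    fused = decide-all (λ k → Meeting (h ∷ʳ k)) (λ k → meeting-down (h ∷ʳ k)) e
    e₁ = proj₁ fused
    e₁≤ = proj₁ (proj₂ fused)
    pick : ∀ h e → Dec (Meeting h e) → 𝕌
    pick h e (yes p) = proj₁ p
    pick h e (no _)  = Y , Y∈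
    pick-correct : ∀ h e (d : Dec (Meeting h e)) → Meeting h e → Meets (pick h e d) h e
    pick-correct h e (yes (_ , μ)) _ = μ
    pick-correct h e (no ¬p)       p = ⊥-elim (¬p p)
    chosen : ℕ × List Bool → 𝕌
    chosen (k , t) = pick (h ∷ʳ k) (e₁ ↾ t) em
    below = diagonal (Y , Y∈) chosen
    Y∞ = proj₁ below
    extends : ∀ g Z → Z ≼ proj₁ Y∞ →
              ¬ (∃[ k ] (vec k ∈ ⟨ map vec h ⌢ seq Z ⟩ × ∃[ n ] D (e₁ ↾ applyUpTo g n) k)) →
              ∀ {v} → v ∈ ⟨ seq Z ⟩ → ∃[ e′ ] (e′ ≤ᶜ e × Avoidable (h ∷ʳ code v) e′)
    extends g Z Z≼ miss {v} v∈ =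
      go (proj₂ (proj₂ (proj₂ fused) k) t (List.length-applyUpTo g N))
      where
      k = code v
      N = proj₁ (proj₂ (proj₂ fused) k)
      t = applyUpTo g N
      sub : ∀ n → ⟨ map vec (h ∷ʳ k) ⌢ seq (dropᵇ n Z) ⟩ ⊆ ⟨ map vec h ⌢ seq Z ⟩
      sub n = ⟨⌢⟩-⊆ {map vec (h ∷ʳ k)} {seq (dropᵇ n Z)} {map vec h} {seq Z}
        (subst (All (_∈ ⟨ map vec h ⌢ seq Z ⟩)) (sym (List.map-++ vec h [ k ]))
          (All.++⁺ (⌢-membersˡ (map vec h) (seq Z))
            (⟨⟩-least (⟨⟩-isSubspace (map vec h ⌢ seq Z)) {x = seq Z} (⌢-membersʳ (map vec h) (seq Z))
              (IsSubspace.resp (⟨⟩-isSubspace (seq Z)) (≈ᴹ-sym (vec-code v)) v∈) ∷ [])))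
        (λ i → member (seq Z) (n + i))
      go : Decided (Meeting (h ∷ʳ k)) (e₁ ↾ t) → ∃[ e′ ] (e′ ≤ᶜ e × Avoidable (h ∷ʳ k) e′)
      go (inj₂ avoids) = e₁ ↾ t , ≤ᶜ-trans (↾-≤ e₁ t) e₁≤ , avoids
      go (inj₁ meets)  =
        case ≼*-tail {proj₁ Y∞} {proj₁ (chosen (k , t))} {Z} (proj₂ (proj₂ below) (k , t)) Z≼ of λ { (n , Z′≼) →
        case pick-correct (h ∷ʳ k) (e₁ ↾ t) em meets (λ i → g (N + i)) (dropᵇ n Z) Z′≼ of λ { (j , j∈ , n′ , d) →
        ⊥-elim (miss (j , sub n j∈ , N + n′ , D-down j (applyUpTo-↾⁻ e₁ g N n′) d)) } }

  -- `Full` applies here because the branch has disappeared behind the quantifier over `e′`: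
  -- `Extendible` is one subset of E.
  avoid-step : ∀ h e → Avoidable h e →
    Σ[ Y ∈ 𝕌 ] (∀ {v} → v ∈ ⟨ seq (proj₁ Y) ⟩ → ∃[ e′ ] (e′ ≤ᶜ e × Avoidable (h ∷ʳ code v) e′))
  avoid-step h e avoid =
    case full Extendible respects (proj₁ someᵁ) (proj₂ someᵁ)
           (λ Y (Y∈ , _) → case avoid-extension h e avoid Y Y∈ of λ { (Z , Z≼ , q) → Z , Z≼ , λ v∈ → small (q v∈) })
    of λ { (Y , (Y∈ , _) , q) → (Y , Y∈) , λ v∈ → unsmall (q v∈) }
    where
    Extendible : Pred V 0ℓ
    Extendible v = Small (∃[ e′ ] (e′ ≤ᶜ e × Avoidable (h ∷ʳ code v) e′))
    respects : ∀ {v w} → v ≈ᴹ w → Extendible v → Extendible w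
    respects p = subst (λ k → Small (∃[ e′ ] (e′ ≤ᶜ e × Avoidable (h ∷ʳ k) e′))) (code-cong p)

  module Steer (e₀ : Cond) (avoid₀ : Avoidable [] e₀) where

    private
      extend : ∀ h k e → Dec (∃[ e′ ] (e′ ≤ᶜ e × Avoidable (h ∷ʳ k) e′)) → ∃[ e′ ] e′ ≤ᶜ e
      extend h k e (yes (e′ , p , _)) = e′ , p
      extend h k e (no _)             = e , ≤ᶜ-refl

      extend-avoids : ∀ h k e d → ∃[ e′ ] (e′ ≤ᶜ e × Avoidable (h ∷ʳ k) e′) →
                      Avoidable (h ∷ʳ k) (proj₁ (extend h k e d))
      extend-avoids h k e (yes (_ , _ , q)) _ = q
      extend-avoids h k e (no ¬q)           q = ⊥-elim (¬q q)

      abstract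
        r : Steering
        r h k e = extend h k e em

        r-avoids : ∀ h k e → ∃[ e′ ] (e′ ≤ᶜ e × Avoidable (h ∷ʳ k) e′) → Avoidable (h ∷ʳ k) (proj₁ (r h k e))
        r-avoids h k e = extend-avoids h k e em

      Avoiding : List ℕ → Set (c ⊔ ℓ ⊔ m ⊔ ℓm ⊔ δ ⊔ u)
      Avoiding h = ∀ t → length t ≡ length h → Avoidable h (steer r e₀ h t)

      Extends : List ℕ → List Bool → 𝕌 → Set (c ⊔ ℓ ⊔ m ⊔ ℓm ⊔ δ ⊔ u)
      Extends h t Y = ∀ i {v} → v ∈ ⟨ seq (proj₁ Y) ⟩ →
        ∃[ e′ ] (e′ ≤ᶜ steer r e₀ h t ↾ [ i ] × Avoidable (h ∷ʳ code v) e′)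

      extending : ∀ h → Avoiding h → Σ[ Y ∈ 𝕌 ] (∀ t → length t ≡ length h → Extends h t Y)
      -- One subspace must serve every node of the current level and both turns after it; these are
      -- finitely many.
      extending h avoids = uniform (Extends h) (λ t Y≼X p i v∈ → p i (Y≼X v∈)) (length h) λ t l →
        let e = steer r e₀ h t
            step = λ i → avoid-step h (e ↾ [ i ]) (never-down (Meeting h) (↾-≤ e [ i ]) (avoids t l))
        in proj₁ (step false) ∧ᵁ proj₁ (step true) ,
           λ { false v∈ → proj₂ (step false) (∧ᵁ-≼ˡ _ _ v∈)
             ; true  v∈ → proj₂ (step true)  (∧ᵁ-≼ʳ _ _ v∈) }

      bestBelow : ∀ h → Dec (Avoiding h) → 𝕌
      bestBelow h (yes p) = proj₁ (extending h p)
      bestBelow h (no _)  = someᵁ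

      bestBelow-extends : ∀ h d → Avoiding h → ∀ t → length t ≡ length h → Extends h t (bestBelow h d)
      bestBelow-extends h (yes p) _ = proj₂ (extending h p)
      bestBelow-extends h (no ¬p) p = ⊥-elim (¬p p)

      best : List ℕ → 𝕌
      best h = bestBelow h em

      X : Σ[ X ∈ 𝕌 ] (proj₁ X ≼ proj₁ someᵁ × ∀ h → proj₁ X ≼* proj₁ (best h))
      X = diagonal someᵁ best

      next : ∀ h → Avoiding h → ∀ Z → Z ≼ proj₁ (proj₁ X) →
             ∃[ k ] (vec k ∈ ⟨ seq Z ⟩ × Fresh h k × Avoiding (h ∷ʳ k))
      next h avoids Z Z≼X =
        case ≼*-tail {proj₁ (proj₁ X)} {proj₁ (best h)} {Z} (proj₂ (proj₂ X) h) Z≼X of λ { (n , Z′≼) →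
        case fresh-member (dropᵇ n Z) h 0 of λ { (j , _ , fresh) →
          code (seq Z (n + j)) ,
          IsSubspace.resp (⟨⟩-isSubspace (seq Z)) (≈ᴹ-sym (vec-code (seq Z (n + j)))) (member (seq Z) (n + j)) ,
          fresh ,
          λ t l → case unsnoc (length h) t (trans l (length-∷ʳ (code (seq Z (n + j))) h)) of λ { (s , i , p , q) →
            subst (Avoidable (h ∷ʳ code (seq Z (n + j))))
              (trans (sym (steer-∷ʳ r e₀ h _ s i q)) (cong (steer r e₀ (h ∷ʳ code (seq Z (n + j)))) (sym p)))
              (r-avoids h _ _ (bestBelow-extends h em avoids s q i (Z′≼ (member (seq (dropᵇ n Z)) j)))) } } }

      root : Avoiding []
      root [] _ = avoid₀

      module B = Builder ∅ (proj₁ (proj₁ X)) Avoiding root next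

    never : Σ[ e′ ∈ Cond ] Σ[ Y ∈ 𝕌 ] (e′ ≤ᶜ e₀ × (∀ k → vec k ∈ ⟨ seq (proj₁ Y) ⟩ → Never (λ e → D e k) e′))
    never =
      case strategic (proj₁ (proj₁ X)) (proj₂ (proj₁ X)) B.strategy of λ { (Z , out , Z∈) →
      case B.outcome-branch Z out of λ { (b , avoids , _ , Z≋) →
      case fuse-along (steered r b) e₀ of λ { (e∞ , e∞≤ , below) →
        e∞ , (Z , Z∈) , e∞≤ , λ k k∈ →
        case ⟨⟩-finite {vec ∘ b} (≋⇒⊆ {seq Z} {vec ∘ b} Z≋ k∈) of λ { (n , k∈n) →
        additive (Never (λ e → D e k)) (never-additive (λ e → D e k) (D-down k)) n e∞ λ t l e′ e′≤ d →
          avoids n t (trans l (sym (List.length-applyUpTo b n))) e′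
            (≤ᶜ-trans e′≤ (≤ᶜ-trans (below t)
              (≡⇒≤ᶜ (trans (run-steered r b e₀ t) (cong (λ j → steer r e₀ (applyUpTo b j) t) l)))))
            -- A vector in the span of the first `n` moves meets `D` whatever follows, so any member
            -- of `U` gives a `Meeting`, contrary to avoidance.
            (someᵁ , λ g Y _ → k , subst (λ vs → vec k ∈ ⟨ vs ⌢ seq Y ⟩) (sym (List.map-applyUpTo b vec n)) (k∈n (seq Y)) ,
              0 , d) } } } }

  fullness : ∀ e → (∃[ e′ ] (e′ ≤ᶜ e × Σ[ Y ∈ 𝕌 ] (∀ k → vec k ∈ ⟨ seq (proj₁ Y) ⟩ → Never (λ e → D e k) e′)))
                 ⊎ (∃[ e′ ] (e′ ≤ᶜ e × Meeting [] e′))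
  fullness e = case decided-dense (Meeting []) e of λ
    { (e′ , p , inj₁ meets)  → inj₂ (e′ , p , meets)
    ; (e′ , p , inj₂ avoids) → case Steer.never e′ avoids of λ { (e″ , Y , q , h) → inj₁ (e″ , ≤ᶜ-trans q p , Y , h) } }

-- The game with witnesses

take-applyUpTo : ∀ {a} {A : Set a} (f : ℕ → A) {m n} → m ≤ n → take m (applyUpTo f n) ≡ applyUpTo f m
take-applyUpTo f z≤n       = refl
take-applyUpTo f (s≤s m≤n) = cong (f 0 ∷_) (take-applyUpTo (f ∘ suc) m≤n)

◂-∷ʳ : ∀ {a} {A : Set a} (s : List A) {f} → s ◂ f → s ∷ʳ f (length s) ◂ f
◂-∷ʳ s {f} p = trans (cong (applyUpTo f) (length-∷ʳ _ s))
  (trans (sym (List.applyUpTo-∷ʳ f (length s))) (cong (_∷ʳ f (length s)) p))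

module Unfolded (em : ∀ {l} → ExcludedMiddle l) {c ℓ m ℓm u κ : Level} {F : Field c ℓ}
                (countable : Countable F) (E : SpaceWithBasis F m ℓm)
                (U : Pred (BlockSequences.BlockSeq E) u) (isP⁺ : BlockSequences.IsP⁺Filter E U)
                (strategic : BlockSequences.Strategic E U)
                (C : BlockSequences.Point E → (ℕ → ℕ) → Set κ) where

  open Classical em
  open LinearAlgebra em countable E
  open SpaceWithBasis E hiding (module F; e)
  open BlockSequences E hiding (_↾_)
  open Games em countable E
  open Filters em countable E U isP⁺
  open Deciding em

  private
    L : Level
    L = c ⊔ ℓ ⊔ m ⊔ ℓm ⊔ u ⊔ κ

  Follows : (List ℕ → 𝕌) → ℕ → BlockSeq → Set (c ⊔ ℓm)
  Follows τ n Z = ∀ j → n ≤ j → seq Z j ∈ ⟨ seq (proj₁ (τ (codes (seq Z) j))) ⟩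

  -- Playing members of U amounts to playing natural numbers in F[x,Y], where Y ∈ U is ≼*
  -- all of these members.
  WinsI : List ℕ → List ℕ → Cond → Set L
  WinsI x s e = Σ[ τ ∈ (List ℕ → 𝕌) ] (∀ f → f ∈ᶜ e → ∀ Z → x ◂ code ∘ seq Z → Follows τ (length x) Z →
                                        ∀ w → s ◂ w → ¬ C (f , Z) w)

  winsI-down : ∀ x s → DownClosed (WinsI x s)
  winsI-down x s e′≤e (τ , h) = τ , λ f f∈ → h f (∈ᶜ-mono e′≤e f∈)

  winsI-additive : ∀ x s e → (∀ i → WinsI x s (e ↾ [ i ])) → WinsI x s e
  winsI-additive x s e h = (λ y → proj₁ (h false) y ∧ᵁ proj₁ (h true) y) , λ f f∈ Z x◂ fol w s◂ →
    case ∈ᶜ-split {e} f∈ of λ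
    { (false , f∈′) → proj₂ (h false) f f∈′ Z x◂ (λ j p → ∧ᵁ-≼ˡ _ _ (fol j p)) w s◂
    ; (true  , f∈′) → proj₂ (h true)  f f∈′ Z x◂ (λ j p → ∧ᵁ-≼ʳ _ _ (fol j p)) w s◂ }

  Open-II : List ℕ → List ℕ → Cond → Set L
  Open-II x s = Never (WinsI x s)

  -- The bound on d leaves player I with finitely many witnesses to fight at any time.
  Stop : List ℕ → List ℕ → Cond → Set L
  Stop s y e = ∃[ d ] (d ≤ length y × Open-II y (s ∷ʳ d) e)

  stop-down : ∀ s y → DownClosed (Stop s y)
  stop-down s y p (d , d≤ , o) = d , d≤ , never-down (WinsI y (s ∷ʳ d)) p o

  mutual

    -- Inductive, because the next entry of the witness must come after finitely many moves. How far
    -- along `g` one has to go may depend on the branch and on the subspace I has played.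
    data Reach (Y : BlockSeq) (s : List ℕ) (e : Cond) (x : List ℕ) : Set L where
      reach : (∀ g Z → Z ≼ Y → ReachVia Y s e x g Z) → Reach Y s e x

    ReachVia : BlockSeq → List ℕ → Cond → List ℕ → (ℕ → Bool) → BlockSeq → Set L
    ReachVia Y s e x g Z = Σ[ k ∈ ℕ ] (vec k ∈ ⟨ seq Z ⟩ × Fresh x k × Σ[ n ∈ ℕ ]
      (Stop s (x ∷ʳ k) (e ↾ applyUpTo g n) ⊎ Reach Y s (e ↾ applyUpTo g n) (x ∷ʳ k)))

  reach-map : ∀ {Y Y′ s e e′ x} → Y′ ≼* Y → e′ ≤ᶜ e → Reach Y s e x → Reach Y′ s e′ x
  reachVia-map : ∀ {Y Y′ s e e′ x} → Y′ ≼* Y → (p : e′ ≤ᶜ e) → ∀ g {Z Z′} → ⟨ seq Z′ ⟩ ⊆ ⟨ seq Z ⟩ →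
                 ReachVia Y s e x (image (factor p) g) Z′ → ReachVia Y′ s e′ x g Z
  reach-map {Y} {Y′} Y′≼ p (reach h) = reach λ g Z Z≼ →
    let n , Z′≼ = ≼*-tail {Y′} {Y} {Z} Y′≼ Z≼ in
    reachVia-map {Y} {Y′} Y′≼ p g {Z} {dropᵇ n Z} (dropᵇ-≼ n Z) (h (image (factor p) g) (dropᵇ n Z) Z′≼)
  reachVia-map {s = s} {x = x} Y′≼ p g sub (k , k∈ , fr , n , inj₁ st) =
    k , sub k∈ , fr , n , inj₁ (stop-down s (x ∷ʳ k) (≤ᶜ-image p g n) st)
  reachVia-map {Y} {Y′} Y′≼ p g sub (k , k∈ , fr , n , inj₂ r)  =
    k , sub k∈ , fr , n , inj₂ (reach-map {Y} {Y′} Y′≼ (≤ᶜ-image p g n) r)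

  Reachable : List ℕ → List ℕ → Cond → Set L
  Reachable s x e = Σ[ Y ∈ 𝕌 ] Reach (proj₁ Y) s e x

  reachable-down : ∀ s x → DownClosed (Reachable s x)
  reachable-down s x p (Y , r) = Y , reach-map {proj₁ Y} {proj₁ Y} (0 , id) p r

  module _ (s : List ℕ) where

    Progress : List ℕ → Cond → ℕ → Set L
    Progress x e k = Fresh x k × (Stop s (x ∷ʳ k) e ⊎ Reachable s (x ∷ʳ k) e)

    progress-down : ∀ x k → DownClosed (λ e → Progress x e k)
    progress-down x k p (fr , inj₁ st) = fr , inj₁ (stop-down s (x ∷ʳ k) p st)
    progress-down x k p (fr , inj₂ r)  = fr , inj₂ (reachable-down s (x ∷ʳ k) p r)

    Escape : List ℕ → Cond → Set L
    Escape x e = Σ[ Y ∈ 𝕌 ] (∀ k → vec k ∈ ⟨ seq (proj₁ Y) ⟩ → Never (λ e′ → Progress x e′ k) e)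

    escape-down : ∀ x → DownClosed (Escape x)
    escape-down x p (Y , h) = Y , λ k k∈ → never-down (λ e → Progress x e k) p (h k k∈)

    -- This is `fullness` for the vectors that make progress. In the meeting case the subspaces
    -- witnessing `Reachable` after the various `k` are diagonalised into one.
    reachable-or-escape : ∀ x e → ∃[ e′ ] (e′ ≤ᶜ e × (Reachable s x e′ ⊎ Escape x e′))
    reachable-or-escape x e with Fullness.fullness em countable E U isP⁺ strategic (Progress x) (progress-down x) e
    ... | inj₁ (e′ , p , escape)     = e′ , p , inj₂ escape
    ... | inj₂ (e′ , p , Y , meets)  = e′ , p , inj₁ (proj₁ below , reach λ g Z Z≼ →
      case meets g Z (λ v∈ → proj₁ (proj₂ below) (Z≼ v∈)) of λ
      { (k , k∈ , n , fr , inj₁ st) → k , k∈ , fr , n , inj₁ st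
      ; (k , k∈ , n , fr , inj₂ r)  → k , k∈ , fr , n , inj₂
          (reach-map {proj₁ (chosen (k , applyUpTo g n))} {proj₁ (proj₁ below)} (proj₂ (proj₂ below) (k , applyUpTo g n)) ≤ᶜ-refl
            (pick-correct em r)) })
      where
      pick : ∀ {k t} → Dec (Reachable s (x ∷ʳ k) (e′ ↾ t)) → 𝕌
      pick (yes (Y , _)) = Y
      pick (no _)        = Y
      pick-correct : ∀ {k t} (d : Dec (Reachable s (x ∷ʳ k) (e′ ↾ t))) → Reachable s (x ∷ʳ k) (e′ ↾ t) →
                     Reach (proj₁ (pick d)) s (e′ ↾ t) (x ∷ʳ k)
      pick-correct (yes (_ , r)) _ = r
      pick-correct (no ¬r)       r = ⊥-elim (¬r r)
      chosen : ℕ × List Bool → 𝕌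
      chosen (k , t) = pick {k} {t} em
      below = diagonal Y chosen

    -- Player I escapes from Reachable at every position, and so wins at all later positions
    -- against all the witnesses that II may have announced.
    module Defend (e₀ : Cond) where

      Settled : List ℕ × ℕ → Cond → Set L
      Settled (y , d) e = (Reachable s y e ⊎ Escape y e) × Decided (WinsI y (s ∷ʳ d)) e

      settled-down : ∀ i → DownClosed (Settled i)
      settled-down (y , d) p (inj₁ r , q) = inj₁ (reachable-down s y p r) , decided-down _ (winsI-down y _) p q
      settled-down (y , d) p (inj₂ o , q) = inj₂ (escape-down y p o) , decided-down _ (winsI-down y _) p q

      settled-dense : ∀ i e → ∃[ e′ ] (e′ ≤ᶜ e × Settled i e′)
      settled-dense (y , d) e with reachable-or-escape y e
      ... | e₁ , p₁ , q₁ with decided-dense (WinsI y (s ∷ʳ d)) e₁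
      ...   | e₂ , p₂ , q₂ = e₂ , ≤ᶜ-trans p₂ p₁ , down q₁ , q₂
        where
        down : Reachable s y e₁ ⊎ Escape y e₁ → Reachable s y e₂ ⊎ Escape y e₂
        down (inj₁ r) = inj₁ (reachable-down s y p₂ r)
        down (inj₂ o) = inj₂ (escape-down y p₂ o)

      fused : ∃[ e ] (e ≤ᶜ e₀ × ∀ i → ∃[ n ] ∀ t → length t ≡ n → Settled i (e ↾ t))
      fused = fusion Settled settled-down e₀ (λ i e _ → settled-dense i e)

      e∞ : Cond
      e∞ = proj₁ fused

      Unreachable : List ℕ → Set L
      Unreachable y = Never (Reachable s y) e∞

      escape : ∀ y → Unreachable y → Escape y e∞
      escape y = additive (λ e → Never (Reachable s y) e → Escape y e)
        (λ e h nr → let esc = λ i → h i (never-down (Reachable s y) (↾-≤ e [ i ]) nr) in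
          proj₁ (esc false) ∧ᵁ proj₁ (esc true) , λ k k∈ →
            never-additive (λ e′ → Progress y e′ k) (progress-down y k) e λ
            { false → proj₂ (esc false) k (∧ᵁ-≼ˡ _ _ k∈)
            ; true  → proj₂ (esc true)  k (∧ᵁ-≼ʳ _ _ k∈) })
        (proj₁ (proj₂ (proj₂ fused) (y , 0))) e∞
        (λ t l → λ nr → case proj₁ (proj₂ (proj₂ (proj₂ fused) (y , 0)) t l) of λ
          { (inj₁ r) → ⊥-elim (nr _ ≤ᶜ-refl r) ; (inj₂ o) → o })

      -- `Open-II` is itself a `Never`, so if it never holds then `WinsI` is dense below `e∞`. Where
      -- `WinsI` is decided it must then hold, and it is additive.
      win : ∀ y d → Never (Open-II y (s ∷ʳ d)) e∞ → WinsI y (s ∷ʳ d) e∞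
      win y d = additive (λ e → Never (Open-II y (s ∷ʳ d)) e → WinsI y (s ∷ʳ d) e)
        (λ e h no → winsI-additive y (s ∷ʳ d) e (λ i → h i (never-down (Open-II y (s ∷ʳ d)) (↾-≤ e [ i ]) no)))
        (proj₁ (proj₂ (proj₂ fused) (y , d))) e∞
        (λ t l → λ no → case proj₂ (proj₂ (proj₂ (proj₂ fused) (y , d)) t l) of λ
          { (inj₁ w) → w ; (inj₂ o) → ⊥-elim (no _ ≤ᶜ-refl o) })

      escapeMove : ∀ y → Dec (Unreachable y) → 𝕌
      escapeMove y (yes p) = proj₁ (escape y p)
      escapeMove y (no _)  = someᵁ

      escapeMove-correct : ∀ y d → Unreachable y → ∀ k → vec k ∈ ⟨ seq (proj₁ (escapeMove y d)) ⟩ →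
                           Never (λ e′ → Progress y e′ k) e∞
      escapeMove-correct y (yes p) _ = proj₂ (escape y p)
      escapeMove-correct y (no ¬p) p = ⊥-elim (¬p p)

      winMove : ∀ {y d} → Dec (WinsI y (s ∷ʳ d) e∞) → List ℕ → 𝕌
      winMove (yes (τ , _)) = τ
      winMove (no _)        = λ _ → someᵁ

      winMove-correct : ∀ {y d} (q : Dec (WinsI y (s ∷ʳ d) e∞)) → WinsI y (s ∷ʳ d) e∞ →
        ∀ f → f ∈ᶜ e∞ → ∀ Z → y ◂ code ∘ seq Z → Follows (winMove q) (length y) Z → ∀ w → s ∷ʳ d ◂ w → ¬ C (f , Z) w
      winMove-correct (yes (_ , h)) _ = h
      winMove-correct (no ¬h)       h = ⊥-elim (¬h h)

      pending : List ℕ → ℕ → ℕ → 𝕌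
      pending h n d = winMove {take n h} {d} em h

      -- While escaping, I continues the strategies started at all initial segments `take n h`, each
      -- against one value `d` of the next witness entry. Both ranges stop at the length of `h`,
      -- which keeps the meet finite.
      τ : List ℕ → 𝕌
      τ h = escapeMove h em ∧ᵁ meets (λ n → meets (pending h n) (suc (length h))) (suc (length h))

      τ-escape : ∀ h → proj₁ (τ h) ≼ proj₁ (escapeMove h em)
      τ-escape h = ∧ᵁ-≼ˡ _ _

      τ-pending : ∀ h n d → n ≤ length h → d ≤ length h → proj₁ (τ h) ≼ proj₁ (pending h n d)
      τ-pending h n d n≤ d≤ v∈ = meets-≼ (pending h n) (s≤s d≤)
        (meets-≼ (λ n → meets (pending h n) (suc (length h))) (s≤s n≤) (∧ᵁ-≼ʳ _ _ v∈))

      module Outcome (x : List ℕ) (unreachable : Unreachable x) (Z : BlockSeq)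
                     (x◂ : x ◂ code ∘ seq Z) (follows : Follows τ (length x) Z) where

        pos : ℕ → List ℕ
        pos = codes (seq Z)

        pos-length : ∀ j → length (pos j) ≡ j
        pos-length j = List.length-applyUpTo _ j

        fresh : ∀ j → Fresh (pos j) (code (seq Z j))
        fresh j = code-cong (vec-code _) , NonzeroV-cong (≈ᴹ-sym (vec-code _)) (proj₁ (isBlock Z) j) ,
          All.applyUpTo⁺₁ (code ∘ seq Z) j λ i<j →
            ≺-cong (≈ᴹ-sym (vec-code _)) (≈ᴹ-sym (vec-code _)) (block-≺ (isBlock Z) i<j)

        move∈ : ∀ j → length x ≤ j → ∀ {Y} → proj₁ (τ (pos j)) ≼ Y → vec (code (seq Z j)) ∈ ⟨ seq Y ⟩
        move∈ j p {Y} τ≼ = IsSubspace.resp (⟨⟩-isSubspace (seq Y)) (≈ᴹ-sym (vec-code _)) (τ≼ (follows j p))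

        no-progress : ∀ j → length x ≤ j → Unreachable (pos j) →
                      ∀ e′ → e′ ≤ᶜ e∞ → ¬ (Stop s (pos (suc j)) e′ ⊎ Reachable s (pos (suc j)) e′)
        no-progress j p un e′ e′≤ q = escapeMove-correct (pos j) em un (code (seq Z j))
          (move∈ j p {proj₁ (escapeMove (pos j) em)} (τ-escape (pos j))) e′ e′≤
          (fresh j , subst (λ y → Stop s y e′ ⊎ Reachable s y e′) (sym (List.applyUpTo-∷ʳ (code ∘ seq Z) j)) q)

        unreachable-pos : ∀ i → Unreachable (pos (i + length x))
        unreachable-pos zero    = subst Unreachable (sym x◂) unreachable
        unreachable-pos (suc i) e′ p r =
          no-progress (i + length x) (m≤n+m _ i) (unreachable-pos i) e′ p (inj₂ r)

        wins : ∀ i d → d ≤ suc (i + length x) → WinsI (pos (suc (i + length x))) (s ∷ʳ d) e∞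
        wins i d d≤ = win _ d λ e′ p o → no-progress (i + length x) (m≤n+m _ i) (unreachable-pos i) e′ p
          (inj₁ (d , subst (d ≤_) (sym (pos-length (suc (i + length x)))) d≤ , o))

        avoids : ∀ f → f ∈ᶜ e∞ → ∀ w → s ◂ w → ¬ C (f , Z) w
        avoids f f∈ w s◂ = winMove-correct em (wins d d (≤-trans (m≤m+n d (length x)) (n≤1+n _))) f f∈ Z
          (applyUpTo-◂ (code ∘ seq Z) J)
          (λ j J≤j → let J≤j′ = subst (_≤ j) (pos-length J) J≤j in
            subst (λ y → seq Z j ∈ ⟨ seq (proj₁ (winMove {y} {d} em (pos j))) ⟩) (take-applyUpTo (code ∘ seq Z) J≤j′)
              (τ-pending (pos j) J d (subst (J ≤_) (sym (pos-length j)) J≤j′)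
                (subst (d ≤_) (sym (pos-length j)) (≤-trans (≤-trans (m≤m+n d (length x)) (n≤1+n _)) J≤j′))
                (follows j (≤-trans (≤-trans (m≤n+m (length x) d) (n≤1+n _)) J≤j′))))
          w (◂-∷ʳ s s◂)
          where
          d J : ℕ
          d = w (length s)
          -- At time `J` at least one move has been made after `x`, and the position is long enough
          -- for the bound in `Stop` to cover the actual entry `d`.
          J = suc (d + length x)

    open⇒reachable : ∀ x e → Open-II x s e → ∃[ e′ ] (e′ ≤ᶜ e × Reachable s x e′)
    open⇒reachable x e o = dne λ none →
      let open Defend e
          un = λ e′ p r → none (e′ , ≤ᶜ-trans p (proj₁ (proj₂ fused)) , r)
      in o e∞ (proj₁ (proj₂ fused)) (τ , λ f f∈ Z x◂ fol w s◂ → Outcome.avoids x un Z x◂ fol f f∈ w s◂)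

-- Borel sets as projections of closed sets

module Analytic (em : ∀ {l} → ExcludedMiddle l) {c ℓ m ℓm : Level} {F : Field c ℓ}
                (E : SpaceWithBasis F m ℓm) where

  open Classical em
  open Small em
  open SpaceWithBasis E hiding (module F; e)
  open BlockSequences E

  Closed : ∀ {κ} → (Point → (ℕ → ℕ) → Set κ) → Set (κ ⊔ m ⊔ ℓ ⊔ ℓm)
  Closed C = ∀ P w → ¬ C P w → ∃[ n ] (∀ Q w′ → AgreeBelow n P Q → (∀ i → i < n → w i ≡ w′ i) → ¬ C Q w′)

  agree-refl : ∀ {n P} → AgreeBelow n P P
  agree-refl i _ = refl , ≈ᴹ-refl

  agree-trans : ∀ {n P Q R} → AgreeBelow n P Q → AgreeBelow n Q R → AgreeBelow n P R
  agree-trans p q i i< = trans (proj₁ (p i i<)) (proj₁ (q i i<)) , ≈ᴹ-trans (proj₂ (p i i<)) (proj₂ (q i i<))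

  agree-≤ : ∀ {k n P Q} → k ≤ n → AgreeBelow n P Q → AgreeBelow k P Q
  agree-≤ k≤n p i i< = p i (<-≤-trans i< k≤n)

  closed-resp : ∀ {κ} {C : Point → (ℕ → ℕ) → Set κ} → Closed C → ∀ {P w w′} → (∀ i → w i ≡ w′ i) → C P w → C P w′
  closed-resp closed {P} {w} {w′} eq x = dne λ ¬x → case closed P w′ ¬x of λ { (n , h) →
    h P w (agree-refl {n} {P}) (λ i _ → sym (eq i)) x }

  record Suslin {a} (A : Pred Point a) : Set (a ⊔ Level.suc 0ℓ ⊔ m ⊔ ℓ ⊔ ℓm) where
    field
      base    : Point → (ℕ → ℕ) → Set
      closed  : Closed base
      witness : ∀ {P} → A P → ∃[ w ] base P w
      sound   : ∀ {P w} → base P w → A P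

  open Suslin

  suslin-≐ : ∀ {a b} {A : Pred Point a} {B : Pred Point b} → (∀ {P} → A P → B P) → (∀ {P} → B P → A P) →
             Suslin A → Suslin B
  suslin-≐ f g S = record { base = base S ; closed = closed S ; witness = witness S ∘ g ; sound = f ∘ sound S }

  -- The first entry of the witness names the size of a neighbourhood inside `A`. The base is closed
  -- because fixing that entry and as many coordinates of the point fixes the neighbourhood.
  open-suslin : ∀ {a} {A : Pred Point a} → Open A → Suslin A
  open-suslin {A = A} opn = record
    { base    = λ P w → Small (∀ Q → AgreeBelow (w 0) P Q → A Q)
    ; closed  = λ P w ¬x → suc (w 0) , λ Q w′ p q x → ¬x (small λ R r →
        unsmall x R (subst (λ n → AgreeBelow n Q R) (q 0 z<s)
          (agree-trans {P = Q} {P} {R} (λ i i< → let (u , v) = p i (m<n⇒m<1+n i<) in sym u , ≈ᴹ-sym v) r)))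
    ; witness = λ {P} x → (λ _ → proj₁ (opn P x)) , small (proj₂ (opn P x))
    ; sound   = λ {P} {w} x → unsmall x P (agree-refl {w 0} {P})
    }

  closed-suslin : ∀ {a} {A : Pred Point a} → Open A → Suslin (∁ A)
  closed-suslin {A = A} opn = record
    { base    = λ P w → Small (¬ A P)
    ; closed  = λ P w ¬x → let n , h = opn P (dne λ ¬a → ¬x (small ¬a)) in
        n , λ Q w′ p _ x → unsmall x (h Q p)
    ; witness = λ x → (λ _ → 0) , small x
    ; sound   = unsmall
    }

  union-suslin : ∀ {a} {A : ℕ → Pred Point a} → (∀ n → Suslin (A n)) → Suslin (⋃ ℕ A)
  union-suslin S = record
    { base    = λ P w → base (S (w 0)) P (w ∘ suc)
    ; closed  = λ P w ¬x → let n , h = closed (S (w 0)) P (w ∘ suc) ¬x in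
        suc n , λ Q w′ p q → subst (λ i → ¬ base (S i) Q (w′ ∘ suc)) (q 0 z<s)
          (h Q (w′ ∘ suc) (agree-≤ {P = P} {Q} (n≤1+n n) p) (λ i i< → q (suc i) (s≤s i<)))
    ; witness = λ { (n , x) → let w , y = witness (S n) x in (λ { zero → n ; (suc k) → w k }) , y }
    ; sound   = λ {P} {w} x → w 0 , sound (S (w 0)) x
    }

  pairBound : ℕ → ℕ → ℕ
  pairBound i zero    = 0
  pairBound i (suc n) = suc (pair i n) ⊔ⁿ pairBound i n

  pair<pairBound : ∀ i {k n} → k < n → pair i k < pairBound i n
  pair<pairBound i {k} {suc n} (s≤s k≤n) with m≤n⇒m<n∨m≡n k≤n
  ... | inj₁ k<n  = ≤-trans (pair<pairBound i k<n) (m≤n⊔m (suc (pair i n)) _)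
  ... | inj₂ refl = m≤m⊔n (suc (pair i k)) (pairBound i k)

  intersection-suslin : ∀ {a} {A : ℕ → Pred Point a} → (∀ n → Suslin (A n)) → Suslin (λ P → ∀ n → A n P)
  intersection-suslin S = record
    { base    = λ P w → Small (∀ i → base (S i) P (λ k → w (pair i k)))
    ; closed  = λ P w ¬x → let i , ¬y = ¬∀⇒∃¬ (¬x ∘ small)
                               n , h  = closed (S i) P (λ k → w (pair i k)) ¬y in
        n ⊔ⁿ pairBound i n , λ Q w′ p q x →
          h Q (λ k → w′ (pair i k)) (agree-≤ {P = P} {Q} (m≤m⊔n n _) p)
            (λ k k< → q (pair i k) (<-≤-trans (pair<pairBound i k<) (m≤n⊔m n _)))
            (unsmall x i)
    ; witness = λ {P} x → let w = λ i → witness (S i) (x i) in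
        (λ n → proj₁ (w (proj₁ (unpair n))) (proj₂ (unpair n))) ,
        small λ i → closed-resp (closed (S i))
          (λ k → cong (λ p → proj₁ (w (proj₁ p)) (proj₂ p)) (sym (unpair-pair i k))) (proj₂ (w i))
    ; sound   = λ x n → sound (S n) (unsmall x n)
    }

  -- The complement is carried along in the induction, since complements do not preserve projections
  -- of closed sets.
  borel-suslin : ∀ {a} {A : Pred Point a} → Borel A → Suslin A × Suslin (∁ A)
  borel-suslin (open-set opn) = open-suslin opn , closed-suslin opn
  borel-suslin (complement b) =
    let S , S′ = borel-suslin b in S′ , suslin-≐ (λ x ¬x → ¬x x) dne S
  borel-suslin (union b) =
    union-suslin (λ n → proj₁ (borel-suslin (b n))) ,
    suslin-≐ (λ h (n , x) → h n x) (λ h n x → h (n , x)) (intersection-suslin λ n → proj₂ (borel-suslin (b n)))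
  borel-suslin (ext (f , g) b) =
    let S , S′ = borel-suslin b in suslin-≐ f g S , suslin-≐ (λ ¬x y → ¬x (g y)) (λ ¬y x → ¬y (f x)) S′

-- Perfect trees and embeddings

module _ (p : PerfectTree) where

  open PerfectTree p

  private
    stem : ∀ {w} → node w → List Bool
    stem n = proj₁ (splitting _ n)

    child : ∀ {w} (n : node w) i → node ((w ++ stem n) ∷ʳ i)
    child n false = proj₁ (proj₂ (splitting _ n))
    child n true  = proj₂ (proj₂ (splitting _ n))

    embed : ∀ {w} → node w → List Bool → List Bool
    embed {w} n []      = w ++ stem n
    embed {w} n (i ∷ s) = embed (child n i) s

    embed-node : ∀ {w} (n : node w) s → node (embed n s)
    embed-node n []      = initial _ _ (child n false)
    embed-node n (i ∷ s) = embed-node (child n i) s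

    embed-step : ∀ {w} (n : node w) s i → ∃[ r ] embed n (s ∷ʳ i) ≡ embed n s ++ i ∷ r
    embed-step {w} n []      i = stem (child n i) , List.∷ʳ-++ (w ++ stem n) i _
    embed-step n (j ∷ s) i = embed-step (child n j) s i

  embedding : Cond
  embedding = mkCond (embed (proj₂ nonempty)) (embed-step (proj₂ nonempty))

  embedding-node : ∀ s → node (to embedding s)
  embedding-node = embed-node (proj₂ nonempty)

range : Cond → PerfectTree
range e = record
  { node      = λ t → ∃[ s ] ∃[ r ] to e s ≡ t ++ r
  ; nonempty  = to e [] , [] , [] , sym (List.++-identityʳ _)
  ; initial   = λ { s t (u , r , p) → u , t ++ r , trans p (List.++-assoc s t r) }
  ; splitting = λ { s (u , r , p) → r , extend s u r p false , extend s u r p true }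
  }
  where
  extend : ∀ s u r → to e u ≡ s ++ r → ∀ i → ∃[ v ] ∃[ q ] to e v ≡ ((s ++ r) ∷ʳ i) ++ q
  extend s u r p i = case step e u i of λ { (q , eq) →
    u ∷ʳ i , q , trans eq (trans (cong (_++ i ∷ q) p) (sym (List.∷ʳ-++ (s ++ r) i q))) }

range-≤ : ∀ p {e} → e ≤ᶜ embedding p → range e ≤𝕊 p
range-≤ p (d , q) {t} (s , r , eq) =
  PerfectTree.initial p t r (subst (PerfectTree.node p) (trans (sym (q s)) eq) (embedding-node p (to d s)))

private

  prefixes-compatible : ∀ {a} {A : Set a} (xs : List A) {ys zs ws} → xs ++ zs ≡ ys ++ ws → length xs ≡ length ys → xs ≡ ys
  prefixes-compatible []       {[]}     p l = refl
  prefixes-compatible (x ∷ xs) {y ∷ ys} p l =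
    cong₂ _∷_ (List.∷-injectiveˡ p) (prefixes-compatible xs (List.∷-injectiveʳ p) (suc-injective l))

-- The address is read off `f` itself: its next bit is the value of `f` just past the current root.
branches⇒∈ᶜ : ∀ e {f} → f ∈ Branches (range e) → f ∈ᶜ e
branches⇒∈ᶜ e {f} br = address e , λ n → through n e br
  where
  Br : Cond → Set
  Br e = f ∈ Branches (range e)

  turn : Cond → Bool
  turn e = f (length (to e []))

  root-◂ : ∀ e → Br e → to e [] ◂ f
  root-◂ e br with br (length (to e []))
  ... | u , r , p with to-++ e [] u
  ...   | r′ , q = sym (prefixes-compatible (to e []) (trans (sym q) p) (sym (List.length-applyUpTo f _)))

  turn-br : ∀ e → Br e → Br (e ↾ [ turn e ])
  -- The initial segment is taken longer than the root, so that its node lies beyond the first turn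
  -- and shows which turn `f` takes.
  turn-br e br N with br (N ⊔ⁿ suc (length (to e [])))
  ... | [] , r , p = ⊥-elim (<-irrefl refl (begin-strict
      length (to e [])                              <⟨ m≤n⊔m N _ ⟩
      M                                             ≡⟨ List.length-applyUpTo f M ⟨
      length (applyUpTo f M)                        ≤⟨ m≤m+n _ (length r) ⟩
      length (applyUpTo f M) + length r             ≡⟨ List.length-++ (applyUpTo f M) ⟨
      length (applyUpTo f M ++ r)                   ≡⟨ cong length p ⟨
      length (to e [])                              ∎))
    where
    open ≤-Reasoning
    M = N ⊔ⁿ suc (length (to e []))
  ... | i ∷ u , r , p
    with to-∷ e [] i u
       | applyUpTo-≤ f (m≤m⊔n N (suc (length (to e []))))
       | applyUpTo-≤ f (m≤n⊔m N (suc (length (to e []))))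
  ...   | r₁ , q₁ | r₂ , q₂ | r₃ , q₃ = u , r₂ ++ r ,
    trans (cong (λ j → to e (j ∷ u)) (sym i≡)) (trans p (trans (cong (_++ r) q₂) (List.++-assoc (applyUpTo f N) r₂ r)))
    where
    i≡ : i ≡ turn e
    i≡ = sym (List.∷ʳ-injectiveʳ (applyUpTo f (length (to e []))) (to e [])
      (trans (List.applyUpTo-∷ʳ f (length (to e [])))
        (sym (prefixes-compatible (to e [] ∷ʳ i)
          (trans (List.∷ʳ-++ (to e []) i r₁) (trans (sym q₁) (trans p (trans (cong (_++ r) q₃) (List.++-assoc _ r₃ r)))))
          (trans (length-∷ʳ i (to e [])) (sym (List.length-applyUpTo f _)))))))

  address : Cond → ℕ → Bool
  address e zero    = turn e
  address e (suc n) = address (e ↾ [ turn e ]) n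

  through : ∀ n e → Br e → to e (applyUpTo (address e) n) ◂ f
  through zero    e br = root-◂ e br
  through (suc n) e br = through n (e ↾ [ turn e ]) (turn-br e br)

↾-initial : ∀ e g {n k} → n ≤ k → e ↾ applyUpTo g k ≤ᶜ e ↾ applyUpTo g n
↾-initial e g {n} n≤k = case applyUpTo-≤ g n≤k of λ { (r , p) →
  subst (λ t → e ↾ t ≤ᶜ e ↾ applyUpTo g n) (sym p)
    (≤ᶜ-trans (↾-++ e (applyUpTo g n) r) (↾-≤ (e ↾ applyUpTo g n) r)) }

-- S k says that II may play the vector coded by k, and Good S that S meets all moves of I.
data Plan {l} (Good : (ℕ → Bool) → Set l) (Legal : List ℕ → ℕ → Set l) (Opened : List ℕ → List ℕ → Set l)
          (y s : List ℕ) : Set l where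
  plan : (S : ℕ → Bool) →
         (∀ k → T (S k) → Legal y k × ((∃[ d ] Opened (y ∷ʳ k) (s ∷ʳ d)) ⊎ Plan Good Legal Opened (y ∷ʳ k) s)) →
         Good S → Plan Good Legal Opened y s

-- Following plans from stop to stop

module Stops {l : Level} {Good : (ℕ → Bool) → Set l} {Legal : List ℕ → ℕ → Set l} {Opened : List ℕ → List ℕ → Set l}
             (resume : ∀ {y s} → Opened y s → Plan Good Legal Opened y s) where

  Plan′ : List ℕ → List ℕ → Set l
  Plan′ = Plan Good Legal Opened

  Move : List ℕ → List ℕ → ℕ → Set l
  Move y s k = Legal y k × ((∃[ d ] Opened (y ∷ʳ k) (s ∷ʳ d)) ⊎ Plan′ (y ∷ʳ k) s)

  followUp : ∀ {y s k} → Move y s k → ∃[ s′ ] Plan′ (y ∷ʳ k) s′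
  followUp (_ , inj₁ (d , o)) = _ , resume o
  followUp (_ , inj₂ P)       = _ , P

  Live : ∀ {y s} → Plan′ y s → List ℕ → Set
  Live P             []      = ⊤
  Live (plan S mv _) (k ∷ h) = Σ[ t ∈ T (S k) ] Live (proj₂ (followUp (mv k t))) h

  AllLive : ∀ {y s} → Plan′ y s → (ℕ → ℕ) → Set
  AllLive P b = ∀ n → Live P (applyUpTo b n)

  -- The witness is extended infinitely often, since plans are well founded.
  NextStop : List ℕ → List ℕ → (ℕ → ℕ) → Set l
  NextStop y s b = ∃[ j ] ∃[ d ] Σ[ o ∈ Opened (y ++ applyUpTo b (suc j)) (s ∷ʳ d) ]
    AllLive (resume o) (λ i → b (suc j + i))

  moveStop : ∀ {y y′ s b} → y ≡ y′ → (o : Opened y s) → AllLive (resume o) b →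
             Σ[ o ∈ Opened y′ s ] AllLive (resume o) b
  moveStop refl o live = o , live

  nextStop : ∀ {y s} (P : Plan′ y s) b → AllLive P b → NextStop y s b
  nextStopAfter : ∀ {y s} b (mv : Move y s (b 0)) → AllLive (proj₂ (followUp mv)) (b ∘ suc) → NextStop y s b
  -- Each length `n` brings its own proof that the first move is permitted. They coincide because
  -- `S` is boolean, so all lengths follow the same continuation.
  nextStop (plan S mv _) b live = nextStopAfter b (mv (b 0) (proj₁ (live 1))) λ n →
    subst (λ t → Live (proj₂ (followUp (mv (b 0) t))) (applyUpTo (b ∘ suc) n))
          (Bool.T-irrelevant (proj₁ (live (suc n))) (proj₁ (live 1))) (proj₂ (live (suc n)))
  nextStopAfter b (_ , inj₁ (d , o)) live = 0 , d , o , live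
  nextStopAfter {y} b (_ , inj₂ P) live = case nextStop P (b ∘ suc) live of λ { (j , d , o , live′) →
    suc j , d , moveStop (List.∷ʳ-++ y (b 0) (applyUpTo (b ∘ suc) (suc j))) o live′ }

  module Stages {x̂ : List ℕ} (o₀ : Opened x̂ []) (b : ℕ → ℕ) (live₀ : AllLive (resume o₀) b) where

    record Stage : Set l where
      field
        position : List ℕ
        rest     : ℕ → ℕ
        prefix   : List ℕ
        time     : ℕ
        opn      : Opened position prefix
        live     : AllLive (resume opn) rest
        pos≡     : position ≡ x̂ ++ applyUpTo b time
        rest≡    : ∀ i → rest i ≡ b (time + i)

    open Stage

    successor : (σ : Stage) → Σ[ σ′ ∈ Stage ] (time σ < time σ′ × ∃[ d ] prefix σ′ ≡ prefix σ ∷ʳ d)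
    successor σ = case nextStop (resume (opn σ)) (rest σ) (live σ) of λ { (j , d , o , live′) →
      record
        { position = position σ ++ applyUpTo (rest σ) (suc j)
        ; rest     = λ i → rest σ (suc j + i)
        ; prefix   = prefix σ ∷ʳ d
        ; time     = time σ + suc j
        ; opn      = o
        ; live     = live′
        ; pos≡     = trans (cong₂ _++_ (pos≡ σ) (applyUpTo-cong {f = rest σ} {λ i → b (time σ + i)} (suc j) (λ i _ → rest≡ σ i)))
            (trans (List.++-assoc x̂ (applyUpTo b (time σ)) _) (cong (x̂ ++_) (sym (applyUpTo-+ b (time σ) (suc j)))))
        ; rest≡    = λ i → trans (rest≡ σ (suc j + i)) (cong b (sym (+-assoc (time σ) (suc j) i)))
        } , m<m+n (time σ) z<s , d , refl }

    stage : ℕ → Stage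
    stage zero = record
      { position = x̂ ; rest = b ; prefix = [] ; time = 0
      ; opn = o₀
      ; live = live₀ ; pos≡ = sym (List.++-identityʳ x̂) ; rest≡ = λ i → refl }
    stage (suc n) = proj₁ (successor (stage n))

    stage-time : ∀ n → n ≤ time (stage n)
    stage-time zero    = z≤n
    stage-time (suc n) = ≤-<-trans (stage-time n) (proj₁ (proj₂ (successor (stage n))))

    stage-prefix : ∀ n → ∃[ d ] ∃[ r ] prefix (stage (suc n)) ≡ prefix (stage n) ++ d ∷ r
    stage-prefix n = let d , p = proj₂ (proj₂ (successor (stage n))) in d , [] , p

    w : ℕ → ℕ
    w = limit 0 (prefix ∘ stage)

-- Strategies for the two players

module Dichotomy (em : ∀ {l} → ExcludedMiddle l) {c ℓ m ℓm u κ : Level} {F : Field c ℓ}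
                 (countable : Countable F) (E : SpaceWithBasis F m ℓm)
                 (U : Pred (BlockSequences.BlockSeq E) u) (isP⁺ : BlockSequences.IsP⁺Filter E U)
                 (strategic : BlockSequences.Strategic E U)
                 (C : BlockSequences.Point E → (ℕ → ℕ) → Set κ) (closed : Analytic.Closed em E C) where

  open Classical em
  open LinearAlgebra em countable E
  open SpaceWithBasis E hiding (module F; e)
  open BlockSequences E hiding (_↾_)
  open Games em countable E
  open Filters em countable E U isP⁺
  open Deciding em
  open Unfolded em countable E U isP⁺ strategic C

  private
    L : Level
    L = c ⊔ ℓ ⊔ m ⊔ ℓm ⊔ u ⊔ κ

  ⌢-length : ∀ (vs : List V) y k → (vs ⌢ y) (length vs + k) ≡ y k
  ⌢-length []       y k = refl
  ⌢-length (v ∷ vs) y k = ⌢-length vs y k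

  applyUpTo-⌢ : ∀ {a} {A : Set a} (h : V → A) vs y k →
                applyUpTo (h ∘ (vs ⌢ y)) (length vs + k) ≡ map h vs ++ applyUpTo (h ∘ y) k
  applyUpTo-⌢ h []       y k = refl
  applyUpTo-⌢ h (v ∷ vs) y k = cong (h v ∷_) (applyUpTo-⌢ h vs y k)

  codes-≋ : ∀ {x y} → x ≋ y → ∀ n → codes x n ≡ codes y n
  codes-≋ p n = applyUpTo-cong n λ i _ → code-cong (p i)

  codes-⌢ : ∀ {z vs y} → z ≋ (vs ⌢ y) → ∀ k → codes z (length vs + k) ≡ map code vs ++ codes y k
  codes-⌢ {vs = vs} {y} p k = trans (codes-≋ p (length vs + k)) (applyUpTo-⌢ code vs y k)

  module PlayerI (x : FinBlockSeq) (X : 𝕌) (e : Cond) where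

    private
      x̂ : List ℕ
      x̂ = map code (entries x)

    strategyI : WinsI x̂ [] e →
      Σ[ Y ∈ 𝕌 ] (proj₁ Y ≼ proj₁ X ×
        Σ[ σ ∈ StrategyI ] (∀ f Z → f ∈ᶜ e → Z ∈ OutcomesI x (proj₁ Y) σ → ∀ w → ¬ C (f , Z) w))
    strategyI (τ , wins) = Y , proj₁ (proj₂ below) , σ , avoids
      where
      below : Σ[ Y ∈ 𝕌 ] (proj₁ Y ≼ proj₁ X × ∀ h → proj₁ Y ≼* proj₁ (τ h))
      below = diagonal X τ
      Y : 𝕌
      Y = proj₁ below
      beyond : ∀ h → ∃[ N ] (∀ {v} → v ∈ ⟨ seq (proj₁ Y) ⟩ → N <supp v → v ∈ ⟨ seq (proj₁ (τ h)) ⟩)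
      beyond h = ≼*-far {proj₁ Y} {proj₁ (τ h)} (proj₂ (proj₂ below) h)
      map-code-cong : ∀ {vs ws} → Pointwise _≈ᴹ_ vs ws → map code vs ≡ map code ws
      map-code-cong []       = refl
      map-code-cong (p ∷ ps) = cong₂ _∷_ (code-cong p) (map-code-cong ps)
      σ : StrategyI
      σ = record
        { move = λ vs → proj₁ (beyond (x̂ ++ map code vs))
        ; cong = λ p → cong (λ h → proj₁ (beyond (x̂ ++ h))) (map-code-cong p) }
      avoids : ∀ f Z → f ∈ᶜ e → Z ∈ OutcomesI x (proj₁ Y) σ → ∀ w → ¬ C (f , Z) w
      avoids f Z f∈ (y , _ , _ , y∈ , far-out , Z≋) w = wins f f∈ Z x̂◂ follows w refl
        where
        x̂◂ : x̂ ◂ code ∘ seq Z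
        x̂◂ = trans (cong (codes (seq Z)) (trans (List.length-map code (entries x)) (sym (+-identityʳ _))))
               (trans (codes-⌢ {vs = entries x} Z≋ 0) (List.++-identityʳ x̂))
        follows′ : ∀ k → seq Z (length (entries x) + k) ∈ ⟨ seq (proj₁ (τ (codes (seq Z) (length (entries x) + k)))) ⟩
        follows′ k = subst (λ h → seq Z (length (entries x) + k) ∈ ⟨ seq (proj₁ (τ h)) ⟩)
          (sym (trans (codes-⌢ {vs = entries x} Z≋ k) (cong (x̂ ++_) (sym (List.map-applyUpTo y code k)))))
          (IsSubspace.resp (⟨⟩-isSubspace (seq (proj₁ (τ (x̂ ++ map code (applyUpTo y k))))))
            (≈ᴹ-sym (≈ᴹ-trans (Z≋ (length (entries x) + k)) (≈ᴹ-reflexive (⌢-length (entries x) y k))))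
            (proj₂ (beyond (x̂ ++ map code (applyUpTo y k))) (y∈ k) (far-out k)))
        follows : Follows τ (length x̂) Z
        follows j p = let q = subst (_≤ j) (List.length-map code (entries x)) p in
          subst (λ i → seq Z i ∈ ⟨ seq (proj₁ (τ (codes (seq Z) i))) ⟩) (m+[n∸m]≡n q) (follows′ (j ∸ length (entries x)))

  module PlayerII (x : FinBlockSeq) (X : 𝕌) (e₀ : Cond) (open₀ : Open-II (map code (entries x)) [] e₀) where

    private
      x̂ : List ℕ
      x̂ = map code (entries x)

    fused : ∃[ e ] (e ≤ᶜ e₀ × ∀ i → ∃[ n ] ∀ t → length t ≡ n →
              Decided (Reachable (proj₂ i) (proj₁ i)) (e ↾ t))
    fused = decide-all {I = List ℕ × List ℕ} (λ (y , s) → Reachable s y) (λ (y , s) → reachable-down s y) e₀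

    e : Cond
    e = proj₁ fused

    pick : ∀ {s y t} → Dec (Reachable s y (e ↾ t)) → 𝕌
    pick (yes (Y , _)) = Y
    pick (no _)        = X

    pick-correct : ∀ {s y t} (d : Dec (Reachable s y (e ↾ t))) → Reachable s y (e ↾ t) → Reach (proj₁ (pick d)) s (e ↾ t) y
    pick-correct (yes (_ , r)) _ = r
    pick-correct (no ¬r)       r = ⊥-elim (¬r r)

    chosen : List ℕ × List ℕ × List Bool → 𝕌
    chosen (s , y , t) = pick {s} {y} {t} em

    below : Σ[ Y ∈ 𝕌 ] (proj₁ Y ≼ proj₁ X × ∀ i → proj₁ Y ≼* proj₁ (chosen i))
    below = diagonal X chosen

    Y : BlockSeq
    Y = proj₁ (proj₁ below)

    -- Openness is known at one node of `g` and `Reachable` is decided at another. Below the deeper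
    -- of the two, `open⇒reachable` excludes the negative decision.
    open⇒reach : ∀ g y s n → Open-II y s (e ↾ applyUpTo g n) → ∃[ k ] Reach Y s (e ↾ applyUpTo g k) y
    open⇒reach g y s n o = N ,
      reach-map {proj₁ (chosen (s , y , t))} {Y} (proj₂ (proj₂ below) (s , y , t)) ≤ᶜ-refl
        (pick-correct em (reachable (proj₂ (proj₂ (proj₂ fused) (y , s)) t (List.length-applyUpTo g N))))
      where
      N : ℕ
      N = proj₁ (proj₂ (proj₂ fused) (y , s))
      t : List Bool
      t = applyUpTo g N
      reachable : Decided (Reachable s y) (e ↾ t) → Reachable s y (e ↾ t)
      reachable (inj₁ r)  = r
      reachable (inj₂ no-reach) =
        case open⇒reachable s y (e ↾ applyUpTo g (n ⊔ⁿ N)) (never-down (WinsI y s) (↾-initial e g (m≤m⊔n n N)) o) of λ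
        { (e′ , p , r) → ⊥-elim (no-reach e′ (≤ᶜ-trans p (↾-initial e g (m≤n⊔m n N))) r) }

    module Branch (g : ℕ → Bool) where

      OpenAt : List ℕ → List ℕ → Set L
      OpenAt y s = ∃[ n ] Open-II y s (e ↾ applyUpTo g n)

      -- Reach along the branch g, reorganised so that the continuation depends on the
      -- code of the vector played and not on the subspace it was played from.
      PlanAt : List ℕ → List ℕ → Set L
      PlanAt = Plan (λ S → Lift L (∀ Z → Z ≼ Y → ∃[ k ] (vec k ∈ ⟨ seq Z ⟩ × T (S k))))
                    (λ y k → Lift L (Fresh y k)) OpenAt

      Move : List ℕ → List ℕ → ℕ → Set L
      Move y s k = Lift L (Fresh y k) × ((∃[ d ] OpenAt (y ∷ʳ k) (s ∷ʳ d)) ⊎ PlanAt (y ∷ʳ k) s)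

      private

        -- `Reach` keeps passing to new conditions with new addresses. A link keeps the original `g`
        -- running below the current ones, so that openness found there also holds at some node of
        -- `g`.
        Link : Cond → (ℕ → Bool) → Set
        Link e′ g′ = ∃[ m ] ∀ n → e ↾ applyUpTo g (m + n) ≤ᶜ e′ ↾ applyUpTo g′ n

        link-tail : ∀ {e′ g′} → Link e′ g′ → ∀ k → Link (e′ ↾ applyUpTo g′ k) (λ i → g′ (k + i))
        link-tail {e′} {g′} (m , h) k = m + k , λ n →
          ≤ᶜ-trans (subst (λ i → e ↾ applyUpTo g i ≤ᶜ e′ ↾ applyUpTo g′ (k + n)) (sym (+-assoc m k n)) (h (k + n)))
                   (applyUpTo-↾⁻ e′ g′ k n)

        chosen-move : ∀ {y s} → (∀ Z → Z ≼ Y → ∃[ k ] (vec k ∈ ⟨ seq Z ⟩ × Move y s k)) → PlanAt y s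
        chosen-move {y} {s} h = plan (λ k → does (em {P = Move y s k})) (λ k → extract em)
          (lift λ Z Z≼ → case h Z Z≼ of λ { (k , k∈ , mv) → k , k∈ , inhabited em mv })
          where
          extract : ∀ {k} (d : Dec (Move y s k)) → T (does d) → Move y s k
          extract (yes mv) _ = mv
          inhabited : ∀ {k} (d : Dec (Move y s k)) → Move y s k → T (does d)
          inhabited (yes _) _  = tt
          inhabited (no ¬p) mv = ⊥-elim (¬p mv)

        toPlan : ∀ {y s e′} g′ → Link e′ g′ → Reach Y s e′ y → PlanAt y s
        toMove : ∀ {y s e′} g′ → Link e′ g′ → ∀ {Z} → ReachVia Y s e′ y g′ Z → ∃[ k ] (vec k ∈ ⟨ seq Z ⟩ × Move y s k)
        toPlan {e′ = e′} g′ link (reach h) = chosen-move λ Z Z≼ → toMove {e′ = e′} g′ link {Z} (h g′ Z Z≼)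
        toMove {y} g′ (m , h) (k , k∈ , fr , n , inj₁ (d , _ , o)) =
          k , k∈ , lift fr , inj₁ (d , m + n , never-down (WinsI (y ∷ʳ k) _) (h n) o)
        toMove {e′ = e′} g′ link (k , k∈ , fr , n , inj₂ r) =
          k , k∈ , lift fr , inj₂ (toPlan (λ i → g′ (n + i)) (link-tail {e′} {g′} link n) r)

      abstract
        openPlan : ∀ {y s} → OpenAt y s → PlanAt y s
        openPlan {y} {s} (n , o) = case open⇒reach g y s n o of λ { (k , r) →
          toPlan (λ i → g (k + i)) (k , λ n → applyUpTo-↾⁻ e g k n) r }

      open Stops openPlan using (followUp; Live; AllLive; module Stages)

      live-next : ∀ {y s} (P : PlanAt y s) h → Live P h → ∀ Z → Z ≼ Y →
                  ∃[ k ] (vec k ∈ ⟨ seq Z ⟩ × Fresh (y ++ h) k × Live P (h ∷ʳ k))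
      live-next {y} (plan S mv (lift hits)) [] _ Z Z≼ = case hits Z Z≼ of λ { (k , k∈ , t) →
        k , k∈ , subst (λ p → Fresh p k) (sym (List.++-identityʳ y)) (lower (proj₁ (mv k t))) , t , tt }
      live-next {y} (plan S mv hits) (j ∷ h) (t , l) Z Z≼ = case live-next (proj₂ (followUp (mv j t))) h l Z Z≼ of λ
        { (k , k∈ , fr , l′) → k , k∈ , subst (λ p → Fresh p k) (List.∷ʳ-++ y j h) fr , t , l′ }

      open-root : OpenAt x̂ []
      open-root = 0 , λ e′ p → open₀ e′ (≤ᶜ-trans p (proj₁ (proj₂ fused)))

      private
        P₀ : PlanAt x̂ []
        P₀ = openPlan open-root

      module B = Builder x Y (Live P₀) tt (live-next P₀)

      module Witness (b : ℕ → ℕ) (live₀ : AllLive P₀ b) where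

        open Stages open-root b live₀ public
        open Stage

        -- Otherwise closedness would give an `n` such that no triple agreeing below `n` is in `C`.
        -- At stage `n` the position and the prefix of the witness have length at least `n`, and `k`
        -- bits of `g` fix at least `n` values of the branch. So I would win there with the constant
        -- strategy, although that stage is open for II.
        in-C : ∀ {f Z} → Through e g f → (∀ k → code (vec (b k)) ≡ b k) → seq Z ≋ (entries x ⌢ (vec ∘ b)) → C (f , Z) w
        in-C {f} {Z} thr canonical Z≋ = dne λ ¬c → refute (closed (f , Z) w ¬c)
          where
          refute : ∃[ n ] (∀ Q w′ → AgreeBelow n (f , Z) Q → (∀ i → i < n → w i ≡ w′ i) → ¬ C Q w′) → ⊥
          refute (n , h) = proj₂ (opn σ) (e ↾ applyUpTo g k) (↾-initial e g (m≤m⊔n k₀ n)) ((λ _ → someᵁ) , wins)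
            where
            σ : Stage
            σ = stage n
            k₀ k : ℕ
            k₀ = proj₁ (opn σ)
            k  = k₀ ⊔ⁿ n
            position-length : n ≤ length (position σ)
            position-length = ≤-trans (stage-time n) (≤-trans (≤-reflexive (sym (List.length-applyUpTo b (time σ))))
              (≤-trans (m≤n+m _ (length x̂)) (≤-reflexive (trans (sym (List.length-++ x̂)) (cong length (sym (pos≡ σ)))))))
            position◂ : position σ ◂ code ∘ seq Z
            position◂ = trans (cong (codes (seq Z)) len) (trans (codes-⌢ {vs = entries x} Z≋ (time σ))
              (trans (cong (x̂ ++_) (applyUpTo-cong {f = code ∘ vec ∘ b} {b} (time σ) (λ i _ → canonical i))) (sym (pos≡ σ))))
              where
              len : length (position σ) ≡ length (entries x) + time σ
              len = trans (cong length (pos≡ σ)) (trans (List.length-++ x̂)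
                (cong₂ _+_ (List.length-map code (entries x)) (List.length-applyUpTo b (time σ))))
            wins : ∀ f′ → f′ ∈ᶜ e ↾ applyUpTo g k → ∀ Z′ → position σ ◂ code ∘ seq Z′ →
                   Follows (λ _ → someᵁ) (length (position σ)) Z′ → ∀ w′ → prefix σ ◂ w′ → ¬ C (f′ , Z′) w′
            wins f′ (_ , f′∈) Z′ pos◂ _ w′ s◂ = h (f′ , Z′) w′
              (λ i i< →
                ◂-agree (to e (applyUpTo g k)) {f} {f′} (thr k)
                  (subst (λ t → to e t ◂ f′) (List.++-identityʳ (applyUpTo g k)) (f′∈ 0)) i
                  (<-≤-trans i< (≤-trans (m≤n⊔m k₀ n) (image-length e g k))) ,
                code-injective (◂-agree (position σ) {code ∘ seq Z} {code ∘ seq Z′} position◂ pos◂ i (<-≤-trans i< position-length)))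
              (λ i i< → ◂-agree (prefix σ) {w} {w′} (chain-◂-limit 0 (prefix ∘ stage) stage-prefix n) s◂ i
                (<-≤-trans i< (chain-length 0 (prefix ∘ stage) stage-prefix n)))

      strategyII : ∀ {f} → Through e g f → ∀ Z → Z ∈ OutcomesII B.strategy → ∃[ w ] C (f , Z) w
      strategyII thr Z out = case B.outcome-branch Z out of λ { (b , live , canonical , Z≋) →
        Witness.w b live , Witness.in-C b live {Z = Z} thr canonical Z≋ }

  perfectlyRamsey : ∀ (x : FinBlockSeq) (X : 𝕌) e₀ → Σ[ e ∈ Cond ] Σ[ Y ∈ 𝕌 ] (e ≤ᶜ e₀ × proj₁ Y ≼ proj₁ X ×
    ((Σ[ σ ∈ StrategyI ] (∀ f Z → f ∈ᶜ e → Z ∈ OutcomesI x (proj₁ Y) σ → ∀ w → ¬ C (f , Z) w))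
     ⊎ (∀ f → f ∈ᶜ e → Σ[ α ∈ StrategyII x (proj₁ Y) ] (∀ Z → Z ∈ OutcomesII α → ∃[ w ] C (f , Z) w))))
  perfectlyRamsey x X e₀ = case decided-dense (WinsI (map code (entries x)) []) e₀ of λ
    { (e , p , inj₁ wins) → case PlayerI.strategyI x X e wins of λ { (Y , Y≼ , σ , h) → e , Y , p , Y≼ , inj₁ (σ , h) }
    ; (e , p , inj₂ opn)  → let open PlayerII x X e opn in
        proj₁ fused , proj₁ below , ≤ᶜ-trans (proj₁ (proj₂ fused)) p , proj₁ (proj₂ below) ,
        inj₂ λ { f (g , thr) → Branch.B.strategy g , Branch.strategyII g thr } }

theorem6p4 : ∀ {c ℓ m ℓm u a} →
    (∀ {l} → ExcludedMiddle l) →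
    (F : Field c ℓ) → Countable F →
    (E : SpaceWithBasis F m ℓm) →
    let open BlockSequences E in
    (U : Pred BlockSeq u) → IsP⁺Filter U → Strategic U →
    (A : Pred Point a) → Borel A →
    PerfectlyStrategicallyRamsey U A
theorem6p4 em F countable E U isP⁺ strategic A borel x X X∈ p =
  let open Analytic em E
      S = proj₁ (borel-suslin borel)
      open Suslin S
      e , (Y , Y∈) , e≤ , Y≼ , alternative =
        Dichotomy.perfectlyRamsey em countable E U isP⁺ strategic base closed x (X , X∈) (embedding p)
  in Y , range e , (Y∈ , Y≼) , range-≤ p e≤ ,
     (case alternative of λ
       { (inj₁ (σ , h)) → inj₁ (σ , λ f Z f∈ out x → let w , y = witness x in h f Z (branches⇒∈ᶜ e f∈) out w y)
       ; (inj₂ h) → inj₂ λ f f∈ → let α , k = h f (branches⇒∈ᶜ e f∈) in α , λ Z out → sound (proj₂ (k Z out)) })
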